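{- Consider any instance of $1\mid r_j,p_j=p\mid\sum_jw_jT_j$ with $N\ge1$ jobs. Let $W=\sum_jw_j$, let $F(S)$ denote the total weighted tardiness of a feasible schedule $S$, let $F^*=\min_SF(S)$, and let $\Phi(S)=F(S)+pW$ and $\Phi^*=F^*+pW$. Let $S_{\mathrm{alg}}$ be the schedule returned by the phase-grid assignment algorithm, and put $F_{\mathrm{alg}}=F(S_{\mathrm{alg}})$ and $\Phi_{\mathrm{alg}}=\Phi(S_{\mathrm{alg}})=F_{\mathrm{alg}}+pW$. Then $$F_{\mathrm{alg}}\le F^*+D(I),\qquad D(I)=\frac{p}{2W}\Bigl(W^2-\sum_jw_j^2\Bigr).$$ Consequently, $$\frac{\Phi_{\mathrm{alg}}}{\Phi^*}\le\frac32-\frac{\sum_jw_j^2}{2W^2}\le\frac32-\frac1{2N}<\frac32 .$$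
   Context: Scheduling problem $1\mid r_j,p_j=p\mid\sum_j w_jT_j$. An instance $I$ consists of $N\ge1$ jobs and a single machine. All jobs have the same positive integer processing time $p$; job $j$ has a nonnegative integer release date $r_j$, a nonnegative integer due date $d_j$, and a positive integer weight $w_j$. A feasible schedule $S$ assigns to each job $j$ a (possibly non-integer) real start time $s_j\ge r_j$ so that the intervals $[s_j,s_j+p)$ are pairwise disjoint; idle time is permitted. With $C_j=s_j+p$ and $T_j=(C_j-d_j)^+$, where $x^+=\max\{x,0\}$, the cost is $F(S)=\sum_jw_jT_j$. Phase-grid assignment algorithm. For $a\in[0,p)$, the phase-$a$ grid is the set of nonnegative times $a+kp$, $k\in\mathbb Z$. Let $\mathcal A=\{r_j\bmod p:1\le j\le N\}$. For each distinct $a\in\mathcal A$: 1. For every job $j$ let $R_j(a)=a+p\left\lceil\frac{r_j-a}{p}\right\rceil$ (the release date rounded upward to the phase-$a$ grid). 2. Let $\mathcal T_a=\{R_i(a)+kp:1\le i\le N,\ 0\le k<N\}$. 3. Form the bipartite graph with one node per job and one node per distinct $t\in\mathcal T_a$, with an edge $(j,t)$ of cost $w_j(t+p-d_j)^+$ whenever $t\ge r_j$; find a minimum-cost matching covering every job (time nodes may remain unmatched). 4. Interpret the matching as the schedule in which job $j$ starts at its matched time. The algorithm returns a schedule of least cost $F$ among the schedules so obtained over all $a\in\mathcal A$. -}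

module Defs where

open import Data.Empty using (⊥)
open import Data.Fin.Base using (Fin; zero; suc)
open import Data.Integer.Base as ℤ using (ℤ; +_)
import Data.Integer.Properties as ℤ
open import Data.Integer.Solver using () renaming (module +-*-Solver to ℤ-Solver)
open import Data.List.Base using (List; allFin; map)
open import Data.List.Membership.Propositional using (_∈_)
open import Data.Nat.Base as ℕ using (ℕ; zero; suc; NonZero)
import Data.Nat.Properties as ℕ
open import Data.Product.Base using (∃₂; ∃-syntax; _×_; _,_)
open import Data.Rational.Base as ℚ using (ℚ; 0ℚ; 1ℚ; ½; ∣_∣)
import Data.Rational.Properties as ℚ
import Data.Rational.Unnormalised.Base as ℚᵘ
import Data.Rational.Unnormalised.Properties as ℚᵘ
open import Data.Rational.Solver using () renaming (module +-*-Solver to ℚ-Solver)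
open import Data.Sum.Base using (inj₁; inj₂)
open import Data.Vec.Functional using (Vector; foldr)
open import Function.Base using (_∘_)
open import Function.Definitions using (Injective)
open import Relation.Binary.Definitions using (Tri; tri<; tri≈; tri>)
open import Relation.Binary.PropositionalEquality
open import Relation.Nullary.Negation using (¬_)

-- Cauchy reals: sequences of rationals with an explicit modulus, compared by
-- the setoid equality _≃_.

IsCauchy : (ℕ → ℚ) → Set
IsCauchy z = ∀ ε → 0ℚ ℚ.< ε → ∃[ N ] ∀ m n → N ℕ.≤ m → N ℕ.≤ n → ∣ z m ℚ.- z n ∣ ℚ.≤ ε

record ℝ : Set where
  constructor mkℝ
  field
    seq    : ℕ → ℚ
    cauchy : IsCauchy seq

open ℝ

infix 4 _≤_ _<_ _≃_

record _≤_ (x y : ℝ) : Set where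
  constructor mk≤
  field
    eventually-≤ : ∀ ε → 0ℚ ℚ.< ε → ∃[ N ] ∀ n → N ℕ.≤ n → seq x n ℚ.≤ seq y n ℚ.+ ε

record _<_ (x y : ℝ) : Set where
  constructor mk<
  field
    ε            : ℚ
    ε>0          : 0ℚ ℚ.< ε
    eventually-< : ∃[ N ] ∀ n → N ℕ.≤ n → seq x n ℚ.+ ε ℚ.≤ seq y n

_≃_ : ℝ → ℝ → Set
x ≃ y = x ≤ y × y ≤ x

fromℚ : ℚ → ℝ
fromℚ q = mkℝ (λ _ → q) λ ε ε>0 → 0 , λ _ _ _ _ →
  subst (ℚ._≤ ε) (sym (cong ∣_∣ (ℚ.+-inverseʳ q))) (ℚ.<⇒≤ ε>0)

ℕ→ℚ : ℕ → ℚ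
ℕ→ℚ n = + n ℚ./ 1

fromℤ : ℤ → ℝ
fromℤ z = fromℚ (z ℚ./ 1)

fromℕ : ℕ → ℝ
fromℕ n = fromℚ (ℕ→ℚ n)

0ℝ : ℝ
0ℝ = fromℚ 0ℚ

private
  ∣x-y∣≡∣y-x∣ : ∀ x y → ∣ x ℚ.- y ∣ ≡ ∣ y ℚ.- x ∣
  ∣x-y∣≡∣y-x∣ x y = trans (sym (ℚ.∣-p∣≡∣p∣ (x ℚ.- y))) (cong ∣_∣
    (solve 2 (λ x y → :- (x :- y) := y :- x) refl x y))
    where open ℚ-Solver

  p≤∣p∣ : ∀ p → p ℚ.≤ ∣ p ∣
  p≤∣p∣ p with ℚ.≤-total 0ℚ p
  ... | inj₁ 0≤p = ℚ.≤-reflexive (sym (ℚ.0≤p⇒∣p∣≡p 0≤p))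
  ... | inj₂ p≤0 = ℚ.≤-trans p≤0 (ℚ.0≤∣p∣ p)

  ∣p∣≤q : ∀ {p q} → p ℚ.≤ q → ℚ.- p ℚ.≤ q → ∣ p ∣ ℚ.≤ q
  ∣p∣≤q {p} {q} p≤q -p≤q with ℚ.∣p∣≡p∨∣p∣≡-p p
  ... | inj₁ eq = subst (ℚ._≤ q) (sym eq) p≤q
  ... | inj₂ eq = subst (ℚ._≤ q) (sym eq) -p≤q

  x≤y+∣x-y∣ : ∀ x y → x ℚ.≤ y ℚ.+ ∣ x ℚ.- y ∣
  x≤y+∣x-y∣ x y = subst (ℚ._≤ y ℚ.+ ∣ x ℚ.- y ∣)
    (solve 2 (λ x y → y :+ (x :- y) := x) refl x y)
    (ℚ.+-monoʳ-≤ y (p≤∣p∣ (x ℚ.- y)))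
    where open ℚ-Solver

  x≤y+d⇒x-y≤d : ∀ x y {d} → x ℚ.≤ y ℚ.+ d → x ℚ.- y ℚ.≤ d
  x≤y+d⇒x-y≤d x y {d} h = subst (x ℚ.- y ℚ.≤_)
    (solve 2 (λ y d → y :+ d :- y := d) refl y d)
    (ℚ.+-monoˡ-≤ (ℚ.- y) h)
    where open ℚ-Solver

  0<*0< : ∀ {p q} → 0ℚ ℚ.< p → 0ℚ ℚ.< q → 0ℚ ℚ.< p ℚ.* q
  0<*0< {p} {q} p>0 q>0 = ℚ.positive⁻¹ (p ℚ.* q)
    {{ℚ.pos*pos⇒pos p {{ℚ.positive p>0}} q {{ℚ.positive q>0}}}}

  0<½ : 0ℚ ℚ.< ½
  0<½ = ℚ.positive⁻¹ ½

  0<1 : 0ℚ ℚ.< 1ℚ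
  0<1 = ℚ.positive⁻¹ 1ℚ

-- A sequence that is eventually K-Lipschitz in the terms of two reals is Cauchy.

lipschitz : (z : ℕ → ℚ) (x y : ℝ) (K : ℚ) → 0ℚ ℚ.< K → (N : ℕ) →
  (∀ m n → N ℕ.≤ m → N ℕ.≤ n →
    ∣ z m ℚ.- z n ∣ ℚ.≤ K ℚ.* (∣ seq x m ℚ.- seq x n ∣ ℚ.+ ∣ seq y m ℚ.- seq y n ∣)) →
  IsCauchy z
lipschitz z x y K K>0 N bound ε ε>0 =
  let
    instance
      K-pos = ℚ.positive K>0
      K-nonNeg = ℚ.pos⇒nonNeg K
      K-nonZero = ℚ.pos⇒nonZero K
    η = ½ ℚ.* ((ℚ.1/ K) ℚ.* ε)
    η>0 = 0<*0< 0<½ (0<*0< (ℚ.positive⁻¹ (ℚ.1/ K) {{ℚ.1/pos⇒pos K}}) ε>0)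
    Nx , hx = cauchy x η η>0
    Ny , hy = cauchy y η η>0
    2η≡ε : K ℚ.* (η ℚ.+ η) ≡ ε
    2η≡ε = begin
      K ℚ.* (η ℚ.+ η)
        ≡⟨ solve 3 (λ k i e → k :* (con ½ :* (i :* e) :+ con ½ :* (i :* e))
                               := k :* i :* e) refl K (ℚ.1/ K) ε ⟩
      K ℚ.* (ℚ.1/ K) ℚ.* ε
        ≡⟨ cong (ℚ._* ε) (ℚ.*-inverseʳ K) ⟩
      1ℚ ℚ.* ε
        ≡⟨ ℚ.*-identityˡ ε ⟩
      ε ∎
  in N ℕ.+ (Nx ℕ.+ Ny) , λ m n m≥ n≥ →
    let
      N≤ = ℕ.m≤m+n N (Nx ℕ.+ Ny)
      Nx≤ = ℕ.≤-trans (ℕ.m≤m+n Nx Ny) (ℕ.m≤n+m (Nx ℕ.+ Ny) N)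
      Ny≤ = ℕ.≤-trans (ℕ.m≤n+m Ny Nx) (ℕ.m≤n+m (Nx ℕ.+ Ny) N)
    in ℚ.≤-trans (bound m n (ℕ.≤-trans N≤ m≥) (ℕ.≤-trans N≤ n≥))
      (ℚ.≤-trans
        (ℚ.*-monoˡ-≤-nonNeg K (ℚ.+-mono-≤
          (hx m n (ℕ.≤-trans Nx≤ m≥) (ℕ.≤-trans Nx≤ n≥))
          (hy m n (ℕ.≤-trans Ny≤ m≥) (ℕ.≤-trans Ny≤ n≥))))
        (ℚ.≤-reflexive 2η≡ε))
  where
  open ≡-Reasoning
  open ℚ-Solver

+-cauchy : ∀ x y → IsCauchy (λ n → seq x n ℚ.+ seq y n)
+-cauchy x y = lipschitz (λ n → seq x n ℚ.+ seq y n) x y 1ℚ 0<1 0 λ m n _ _ →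
  subst₂ ℚ._≤_
    (cong ∣_∣ (solve 4 (λ a b c d → (a :- c) :+ (b :- d) := (a :+ b) :- (c :+ d))
       refl (seq x m) (seq y m) (seq x n) (seq y n)))
    (sym (ℚ.*-identityˡ _))
    (ℚ.∣p+q∣≤∣p∣+∣q∣ (seq x m ℚ.- seq x n) (seq y m ℚ.- seq y n))
  where open ℚ-Solver

neg-cauchy : ∀ x → IsCauchy (λ n → ℚ.- seq x n)
neg-cauchy x = lipschitz (λ n → ℚ.- seq x n) x 0ℝ 1ℚ 0<1 0 λ m n _ _ → ℚ.≤-reflexive (begin
    ∣ ℚ.- seq x m ℚ.- ℚ.- seq x n ∣
      ≡⟨ cong ∣_∣ (solve 2 (λ a b → :- a :- :- b := :- (a :- b)) refl (seq x m) (seq x n)) ⟩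
    ∣ ℚ.- (seq x m ℚ.- seq x n) ∣
      ≡⟨ ℚ.∣-p∣≡∣p∣ (seq x m ℚ.- seq x n) ⟩
    ∣ seq x m ℚ.- seq x n ∣
      ≡⟨ solve 1 (λ a → a := con 1ℚ :* (a :+ con 0ℚ)) refl ∣ seq x m ℚ.- seq x n ∣ ⟩
    1ℚ ℚ.* (∣ seq x m ℚ.- seq x n ∣ ℚ.+ 0ℚ) ∎)
  where
  open ≡-Reasoning
  open ℚ-Solver

⊔-cauchy : ∀ x y → IsCauchy (λ n → seq x n ℚ.⊔ seq y n)
⊔-cauchy x y = lipschitz (λ n → seq x n ℚ.⊔ seq y n) x y 1ℚ 0<1 0 λ m n _ _ →
  subst (∣ (seq x m ℚ.⊔ seq y m) ℚ.- (seq x n ℚ.⊔ seq y n) ∣ ℚ.≤_) (sym (ℚ.*-identityˡ _))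
    (nonexpansive (seq x m) (seq y m) (seq x n) (seq y n))
  where
  one-sided : ∀ a b c d {e f} → a ℚ.≤ c ℚ.+ e → b ℚ.≤ d ℚ.+ f → 0ℚ ℚ.≤ e → 0ℚ ℚ.≤ f →
              (a ℚ.⊔ b) ℚ.- (c ℚ.⊔ d) ℚ.≤ e ℚ.+ f
  one-sided a b c d {e} {f} a≤ b≤ e≥0 f≥0 = x≤y+d⇒x-y≤d (a ℚ.⊔ b) (c ℚ.⊔ d) (ℚ.⊔-lub
    (ℚ.≤-trans a≤ (ℚ.+-mono-≤ (ℚ.p≤p⊔q c d)
      (subst (ℚ._≤ e ℚ.+ f) (ℚ.+-identityʳ e) (ℚ.+-monoʳ-≤ e f≥0))))
    (ℚ.≤-trans b≤ (ℚ.+-mono-≤ (ℚ.p≤q⊔p c d)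
      (subst (ℚ._≤ e ℚ.+ f) (ℚ.+-identityˡ f) (ℚ.+-monoˡ-≤ f e≥0)))))

  nonexpansive : ∀ a b c d →
    ∣ (a ℚ.⊔ b) ℚ.- (c ℚ.⊔ d) ∣ ℚ.≤ ∣ a ℚ.- c ∣ ℚ.+ ∣ b ℚ.- d ∣
  nonexpansive a b c d = ∣p∣≤q
    (one-sided a b c d (x≤y+∣x-y∣ a c) (x≤y+∣x-y∣ b d) (ℚ.0≤∣p∣ _) (ℚ.0≤∣p∣ _))
    (subst (ℚ._≤ ∣ a ℚ.- c ∣ ℚ.+ ∣ b ℚ.- d ∣)
      (solve 2 (λ u v → u :- v := :- (v :- u)) refl (c ℚ.⊔ d) (a ℚ.⊔ b))
      (one-sided c d a b
        (subst (λ e → c ℚ.≤ a ℚ.+ e) (∣x-y∣≡∣y-x∣ c a) (x≤y+∣x-y∣ c a))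
        (subst (λ e → d ℚ.≤ b ℚ.+ e) (∣x-y∣≡∣y-x∣ d b) (x≤y+∣x-y∣ d b))
        (ℚ.0≤∣p∣ _) (ℚ.0≤∣p∣ _)))
    where open ℚ-Solver

private
  eventually-bounded : (x : ℝ) → ∃₂ λ B N → 0ℚ ℚ.≤ B × ∀ n → N ℕ.≤ n → ∣ seq x n ∣ ℚ.≤ B
  eventually-bounded x =
    let N , h = cauchy x 1ℚ 0<1
        c = seq x N
    in ∣ c ∣ ℚ.+ 1ℚ , N , ℚ.+-mono-≤ (ℚ.0≤∣p∣ c) (ℚ.<⇒≤ 0<1) , λ n N≤n → begin
      ∣ seq x n ∣
        ≡⟨ cong ∣_∣ (solve 2 (λ a c → a := c :+ (a :- c)) refl (seq x n) c) ⟩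
      ∣ c ℚ.+ (seq x n ℚ.- c) ∣
        ≤⟨ ℚ.∣p+q∣≤∣p∣+∣q∣ c (seq x n ℚ.- c) ⟩
      ∣ c ∣ ℚ.+ ∣ seq x n ℚ.- c ∣
        ≤⟨ ℚ.+-monoʳ-≤ ∣ c ∣ (h n N N≤n ℕ.≤-refl) ⟩
      ∣ c ∣ ℚ.+ 1ℚ ∎
    where
    open ℚ.≤-Reasoning
    open ℚ-Solver

*-cauchy : ∀ x y → IsCauchy (λ n → seq x n ℚ.* seq y n)
*-cauchy x y =
  let
    A , M , A≥0 , hA = eventually-bounded x
    B , N , B≥0 , hB = eventually-bounded y
    K = 1ℚ ℚ.+ (A ℚ.+ B)
    A≤K : A ℚ.≤ K
    A≤K = subst (ℚ._≤ K) (solve 1 (λ a → con 0ℚ :+ (a :+ con 0ℚ) := a) refl A)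
            (ℚ.+-mono-≤ (ℚ.<⇒≤ 0<1) (ℚ.+-monoʳ-≤ A B≥0))
    B≤K : B ℚ.≤ K
    B≤K = subst (ℚ._≤ K) (solve 1 (λ b → con 0ℚ :+ (con 0ℚ :+ b) := b) refl B)
            (ℚ.+-mono-≤ (ℚ.<⇒≤ 0<1) (ℚ.+-monoˡ-≤ B A≥0))
  in lipschitz (λ n → seq x n ℚ.* seq y n) x y K
       (ℚ.+-mono-<-≤ 0<1 (ℚ.+-mono-≤ A≥0 B≥0)) (M ℕ.+ N) λ m n m≥ n≥ →
     let a = seq x m ; b = seq y m ; c = seq x n ; d = seq y n
         instance _ = ℚ.∣-∣-nonNeg (a ℚ.- c)
         instance _ = ℚ.∣-∣-nonNeg (b ℚ.- d)
     in begin
       ∣ a ℚ.* b ℚ.- c ℚ.* d ∣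
         ≡⟨ cong ∣_∣ (solve 4 (λ a b c d → a :* b :- c :* d := b :* (a :- c) :+ c :* (b :- d))
              refl a b c d) ⟩
       ∣ b ℚ.* (a ℚ.- c) ℚ.+ c ℚ.* (b ℚ.- d) ∣
         ≤⟨ ℚ.∣p+q∣≤∣p∣+∣q∣ (b ℚ.* (a ℚ.- c)) (c ℚ.* (b ℚ.- d)) ⟩
       ∣ b ℚ.* (a ℚ.- c) ∣ ℚ.+ ∣ c ℚ.* (b ℚ.- d) ∣
         ≡⟨ cong₂ ℚ._+_ (ℚ.∣p*q∣≡∣p∣*∣q∣ b (a ℚ.- c)) (ℚ.∣p*q∣≡∣p∣*∣q∣ c (b ℚ.- d)) ⟩
       ∣ b ∣ ℚ.* ∣ a ℚ.- c ∣ ℚ.+ ∣ c ∣ ℚ.* ∣ b ℚ.- d ∣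
         ≤⟨ ℚ.+-mono-≤
              (ℚ.*-monoʳ-≤-nonNeg ∣ a ℚ.- c ∣
                (ℚ.≤-trans (hB m (ℕ.≤-trans (ℕ.m≤n+m N M) m≥)) B≤K))
              (ℚ.*-monoʳ-≤-nonNeg ∣ b ℚ.- d ∣
                (ℚ.≤-trans (hA n (ℕ.≤-trans (ℕ.m≤m+n M N) n≥)) A≤K)) ⟩
       K ℚ.* ∣ a ℚ.- c ∣ ℚ.+ K ℚ.* ∣ b ℚ.- d ∣
         ≡⟨ ℚ.*-distribˡ-+ K ∣ a ℚ.- c ∣ ∣ b ℚ.- d ∣ ⟨
       K ℚ.* (∣ a ℚ.- c ∣ ℚ.+ ∣ b ℚ.- d ∣) ∎
  where
  open ℚ.≤-Reasoning
  open ℚ-Solver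

-- The terms of x are eventually ≥ δ > 0; clamping them below by δ alters only
-- finitely many and makes every term invertible.

module Reciprocal (x : ℝ) (δ : ℚ) (δ>0 : 0ℚ ℚ.< δ) where
  open ℚ.≤-Reasoning
  open ℚ-Solver

  1/δ : ℚ
  1/δ = (ℚ.1/ δ) {{ℚ.>-nonZero δ>0}}

  1/δ>0 : 0ℚ ℚ.< 1/δ
  1/δ>0 = ℚ.positive⁻¹ 1/δ {{ℚ.1/pos⇒pos δ {{ℚ.positive δ>0}}}}

  clamp : ℕ → ℚ
  clamp n = δ ℚ.⊔ seq x n

  δ≤clamp : ∀ n → δ ℚ.≤ clamp n
  δ≤clamp n = ℚ.p≤p⊔q δ (seq x n)

  clamp>0 : ∀ n → 0ℚ ℚ.< clamp n
  clamp>0 n = ℚ.<-≤-trans δ>0 (δ≤clamp n)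

  inv : ℕ → ℚ
  inv n = (ℚ.1/ clamp n) {{ℚ.>-nonZero (clamp>0 n)}}

  inv≥0 : ∀ n → 0ℚ ℚ.≤ inv n
  inv≥0 n = ℚ.<⇒≤ (ℚ.positive⁻¹ (inv n) {{ℚ.1/pos⇒pos (clamp n) {{ℚ.positive (clamp>0 n)}}}})

  uv≥0 : ∀ m n → 0ℚ ℚ.≤ inv m ℚ.* inv n
  uv≥0 m n = ℚ.nonNegative⁻¹ _
    {{ℚ.nonNeg*nonNeg⇒nonNeg (inv m) {{ℚ.nonNegative (inv≥0 m)}}
                             (inv n) {{ℚ.nonNegative (inv≥0 n)}}}}

  inv*clamp : ∀ n → inv n ℚ.* clamp n ≡ 1ℚ
  inv*clamp n = ℚ.*-inverseˡ (clamp n) {{ℚ.>-nonZero (clamp>0 n)}}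

  inv≤ : ∀ n → inv n ℚ.≤ 1/δ
  inv≤ n = let instance
                 _ = ℚ.nonNegative (inv≥0 n)
                 _ = ℚ.nonNegative (ℚ.<⇒≤ 1/δ>0)
           in begin
    inv n
      ≡⟨ ℚ.*-identityʳ (inv n) ⟨
    inv n ℚ.* 1ℚ
      ≡⟨ cong (inv n ℚ.*_) (ℚ.*-inverseʳ δ {{ℚ.>-nonZero δ>0}}) ⟨
    inv n ℚ.* (δ ℚ.* 1/δ)
      ≤⟨ ℚ.*-monoˡ-≤-nonNeg (inv n) (ℚ.*-monoʳ-≤-nonNeg 1/δ (δ≤clamp n)) ⟩
    inv n ℚ.* (clamp n ℚ.* 1/δ)
      ≡⟨ ℚ.*-assoc (inv n) (clamp n) 1/δ ⟨
    inv n ℚ.* clamp n ℚ.* 1/δ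
      ≡⟨ cong (ℚ._* 1/δ) (inv*clamp n) ⟩
    1ℚ ℚ.* 1/δ
      ≡⟨ ℚ.*-identityˡ 1/δ ⟩
    1/δ ∎

  difference : ∀ m n → inv m ℚ.- inv n ≡ (inv m ℚ.* inv n) ℚ.* (clamp n ℚ.- clamp m)
  difference m n = sym (begin-equality
    (u ℚ.* v) ℚ.* (b ℚ.- a)
      ≡⟨ solve 4 (λ u v b a → (u :* v) :* (b :- a) := u :* (v :* b) :- v :* (u :* a)) refl u v b a ⟩
    u ℚ.* (v ℚ.* b) ℚ.- v ℚ.* (u ℚ.* a)
      ≡⟨ cong₂ (λ s t → u ℚ.* s ℚ.- v ℚ.* t) (inv*clamp n) (inv*clamp m) ⟩
    u ℚ.* 1ℚ ℚ.- v ℚ.* 1ℚ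
      ≡⟨ cong₂ ℚ._-_ (ℚ.*-identityʳ u) (ℚ.*-identityʳ v) ⟩
    u ℚ.- v ∎)
    where
    a = clamp m
    b = clamp n
    u = inv m
    v = inv n

  clamp≤ : ∀ m n → clamp m ℚ.≤ clamp n ℚ.+ ∣ seq x m ℚ.- seq x n ∣
  clamp≤ m n = ℚ.⊔-lub
    (ℚ.≤-trans (δ≤clamp n) (subst (ℚ._≤ clamp n ℚ.+ ∣ seq x m ℚ.- seq x n ∣)
      (ℚ.+-identityʳ (clamp n)) (ℚ.+-monoʳ-≤ (clamp n) (ℚ.0≤∣p∣ (seq x m ℚ.- seq x n)))))
    (ℚ.≤-trans (x≤y+∣x-y∣ (seq x m) (seq x n))
      (ℚ.+-monoˡ-≤ ∣ seq x m ℚ.- seq x n ∣ (ℚ.p≤q⊔p δ (seq x n))))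

  clamp-nonexpansive : ∀ m n → ∣ clamp m ℚ.- clamp n ∣ ℚ.≤ ∣ seq x m ℚ.- seq x n ∣
  clamp-nonexpansive m n = ∣p∣≤q
    (x≤y+d⇒x-y≤d (clamp m) (clamp n) (clamp≤ m n))
    (subst₂ ℚ._≤_
      (solve 2 (λ u v → u :- v := :- (v :- u)) refl (clamp n) (clamp m))
      (∣x-y∣≡∣y-x∣ (seq x n) (seq x m))
      (x≤y+d⇒x-y≤d (clamp n) (clamp m) (clamp≤ n m)))

  K : ℚ
  K = 1/δ ℚ.* 1/δ

  inv-lipschitz : ∀ m n →
    ∣ inv m ℚ.- inv n ∣ ℚ.≤ K ℚ.* (∣ seq x m ℚ.- seq x n ∣ ℚ.+ 0ℚ)
  inv-lipschitz m n = begin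
    ∣ u ℚ.- v ∣
      ≡⟨ cong ∣_∣ (difference m n) ⟩
    ∣ (u ℚ.* v) ℚ.* (b ℚ.- a) ∣
      ≡⟨ ℚ.∣p*q∣≡∣p∣*∣q∣ (u ℚ.* v) (b ℚ.- a) ⟩
    ∣ u ℚ.* v ∣ ℚ.* ∣ b ℚ.- a ∣
      ≡⟨ cong (ℚ._* ∣ b ℚ.- a ∣) (ℚ.0≤p⇒∣p∣≡p (uv≥0 m n)) ⟩
    (u ℚ.* v) ℚ.* ∣ b ℚ.- a ∣
      ≤⟨ ℚ.*-monoʳ-≤-nonNeg ∣ b ℚ.- a ∣ (ℚ.≤-trans
           (ℚ.*-monoˡ-≤-nonNeg u (inv≤ n)) (ℚ.*-monoʳ-≤-nonNeg 1/δ (inv≤ m))) ⟩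
    K ℚ.* ∣ b ℚ.- a ∣
      ≤⟨ ℚ.*-monoˡ-≤-nonNeg K (clamp-nonexpansive n m) ⟩
    K ℚ.* ∣ seq x n ℚ.- seq x m ∣
      ≡⟨ cong (K ℚ.*_) (∣x-y∣≡∣y-x∣ (seq x n) (seq x m)) ⟩
    K ℚ.* ∣ seq x m ℚ.- seq x n ∣
      ≡⟨ cong (K ℚ.*_) (sym (ℚ.+-identityʳ _)) ⟩
    K ℚ.* (∣ seq x m ℚ.- seq x n ∣ ℚ.+ 0ℚ) ∎
    where
    a = clamp m
    b = clamp n
    u = inv m
    v = inv n
    instance
      1/δ-nonNeg = ℚ.nonNegative (ℚ.<⇒≤ 1/δ>0)
      K-nonNeg = ℚ.nonNeg*nonNeg⇒nonNeg 1/δ 1/δ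
      u-nonNeg = ℚ.nonNegative (inv≥0 m)
      ab-nonNeg = ℚ.∣-∣-nonNeg (b ℚ.- a)

  inv-cauchy : IsCauchy inv
  inv-cauchy = lipschitz inv x 0ℝ K (0<*0< 1/δ>0 1/δ>0) 0 λ m n _ _ →
    inv-lipschitz m n

infixl 6 _+_ _-_ _⊔_
infixl 7 _*_ _÷_[_]
infix  8 -_ _⁻¹[_]

-- Opaque because the terms are costly to normalise.

opaque
  _+_ : ℝ → ℝ → ℝ
  x + y = mkℝ (λ n → seq x n ℚ.+ seq y n) (+-cauchy x y)

  -_ : ℝ → ℝ
  - x = mkℝ (λ n → ℚ.- seq x n) (neg-cauchy x)

  _⊔_ : ℝ → ℝ → ℝ
  x ⊔ y = mkℝ (λ n → seq x n ℚ.⊔ seq y n) (⊔-cauchy x y)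

  _*_ : ℝ → ℝ → ℝ
  x * y = mkℝ (λ n → seq x n ℚ.* seq y n) (*-cauchy x y)

  _⁻¹[_] : (x : ℝ) → 0ℝ < x → ℝ
  x ⁻¹[ mk< δ δ>0 _ ] = mkℝ (Reciprocal.inv x δ δ>0) (Reciprocal.inv-cauchy x δ δ>0)

_-_ : ℝ → ℝ → ℝ
x - y = x + - y

_÷_[_] : ℝ → (y : ℝ) → 0ℝ < y → ℝ
x ÷ y [ y>0 ] = x * (y ⁻¹[ y>0 ])

_⁺ : ℝ → ℝ
x ⁺ = x ⊔ 0ℝ

∑ℝ : ∀ {n} → Vector ℝ n → ℝ
∑ℝ = foldr _+_ 0ℝ

∑ℤ : ∀ {n} → Vector ℤ n → ℤ
∑ℤ = foldr ℤ._+_ (+ 0)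

∑ℕ : ∀ {n} → Vector ℕ n → ℕ
∑ℕ = foldr ℕ._+_ 0

private
  ∑ℕ-nonZero : ∀ {n} {{_ : NonZero n}} (v : Vector ℕ n) → (∀ j → NonZero (v j)) → NonZero (∑ℕ v)
  ∑ℕ-nonZero {suc n} v v≢0 = ℕ.>-nonZero
    (ℕ.<-≤-trans (ℕ.>-nonZero⁻¹ (v zero) {{v≢0 zero}}) (ℕ.m≤m+n _ _))

  /1-+-mono : ∀ u v p → v ℤ.+ + p ℤ.≤ u → v ℚ./ 1 ℚ.+ ℕ→ℚ p ℚ.≤ u ℚ./ 1
  /1-+-mono u v p v+p≤u = ℚ.toℚᵘ-cancel-≤ (begin
    ℚ.toℚᵘ (v ℚ./ 1 ℚ.+ ℕ→ℚ p)            ≃⟨ ℚ.toℚᵘ-homo-+ (v ℚ./ 1) (ℕ→ℚ p) ⟩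
    ℚ.toℚᵘ (v ℚ./ 1) ℚᵘ.+ ℚ.toℚᵘ (ℕ→ℚ p)  ≃⟨ ℚᵘ.+-cong (ℚ.toℚᵘ-fromℚᵘ (ℚᵘ.mkℚᵘ v 0))
                                                       (ℚ.toℚᵘ-fromℚᵘ (ℚᵘ.mkℚᵘ (+ p) 0)) ⟩
    ℚᵘ.mkℚᵘ v 0 ℚᵘ.+ ℚᵘ.mkℚᵘ (+ p) 0      ≤⟨ ℚᵘ.*≤* (ℤ.*-monoʳ-≤-nonNeg (+ 1)
                                                (subst (ℤ._≤ u) (sym (cong₂ ℤ._+_
                                                  (ℤ.*-identityʳ v) (ℤ.*-identityʳ (+ p)))) v+p≤u)) ⟩
    ℚᵘ.mkℚᵘ u 0                           ≃⟨ ℚ.toℚᵘ-fromℚᵘ (ℚᵘ.mkℚᵘ u 0) ⟨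
    ℚ.toℚᵘ (u ℚ./ 1)                      ∎)
    where open ℚᵘ.≤-Reasoning

  fromℕ≤fromℤ : ∀ m z → + m ℤ.≤ z → fromℕ m ≤ fromℤ z
  fromℕ≤fromℤ m z m≤z = mk≤ λ ε ε>0 → 0 , λ _ _ → begin
    ℕ→ℚ m               ≡⟨ ℚ.+-identityʳ (ℕ→ℚ m) ⟨
    ℕ→ℚ m ℚ.+ ℕ→ℚ 0     ≤⟨ /1-+-mono z (+ m) 0 (subst (ℤ._≤ z) (sym (ℤ.+-identityʳ (+ m))) m≤z) ⟩
    z ℚ./ 1             ≡⟨ ℚ.+-identityʳ (z ℚ./ 1) ⟨
    z ℚ./ 1 ℚ.+ 0ℚ      ≤⟨ ℚ.+-monoʳ-≤ (z ℚ./ 1) (ℚ.<⇒≤ ε>0) ⟩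
    z ℚ./ 1 ℚ.+ ε       ∎
    where open ℚ.≤-Reasoning

  opaque
    unfolding _+_

    slots-disjoint : ∀ u v p x → v ℤ.+ + p ℤ.≤ u →
                     fromℤ u ≤ x → ¬ (x < fromℤ v + fromℕ p)
    slots-disjoint u v p x v+p≤u (mk≤ u≤x) (mk< ε ε>0 (M , x<)) =
      let
        instance _ = ℚ.positive ε>0
        N , hu = u≤x (½ ℚ.* ε) (0<*0< 0<½ ε>0)
        n = M ℕ.+ N
        ½ε<ε : ½ ℚ.* ε ℚ.< ε
        ½ε<ε = subst (½ ℚ.* ε ℚ.<_) (ℚ.*-identityˡ ε) (ℚ.*-monoˡ-<-pos ε {½} {1ℚ} ½<1)
      in ℚ.<-irrefl refl (begin-strict
        u ℚ./ 1               ≤⟨ hu n (ℕ.m≤n+m N M) ⟩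
        seq x n ℚ.+ ½ ℚ.* ε   <⟨ ℚ.+-monoʳ-< (seq x n) ½ε<ε ⟩
        seq x n ℚ.+ ε         ≤⟨ x< n (ℕ.m≤m+n M N) ⟩
        v ℚ./ 1 ℚ.+ ℕ→ℚ p     ≤⟨ /1-+-mono u v p v+p≤u ⟩
        u ℚ./ 1               ∎)
      where
      open ℚ.≤-Reasoning
      ½<1 : ½ ℚ.< 1ℚ
      ½<1 = ℚ.*<* (ℤ.+<+ (ℕ.s≤s (ℕ.s≤s ℕ.z≤n)))

record Instance : Set where
  field
    N p   : ℕ
    r d w : Fin N → ℕ
    {{N≢0}} : NonZero N
    {{p≢0}} : NonZero p
    w≢0     : ∀ j → NonZero (w j)

module Problem (I : Instance) where
  open Instance I public

  -- Membership in the half-open processing interval [ s , s + p ).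
  _∈[_,+p⟩ : ℝ → ℝ → Set
  t ∈[ s ,+p⟩ = s ≤ t × t < s + fromℕ p

  record Schedule : Set where
    field
      start    : Fin N → ℝ
      released : ∀ j → fromℕ (r j) ≤ start j
      disjoint : ∀ i j → i ≢ j → ∀ t → ¬ (t ∈[ start i ,+p⟩ × t ∈[ start j ,+p⟩)

  open Schedule public

  C : Schedule → Fin N → ℝ
  C S j = start S j + fromℕ p

  T : Schedule → Fin N → ℝ
  T S j = (C S j - fromℕ (d j)) ⁺

  F : Schedule → ℝ
  F S = ∑ℝ λ j → fromℕ (w j) * T S j

  IsMinimumCost : ℝ → Set
  IsMinimumCost F* = (∃[ S ] F S ≃ F*) × (∀ S → F* ≤ F S)

  W : ℕ
  W = ∑ℕ w

  ∑w² : ℕ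
  ∑w² = ∑ℕ λ j → w j ℕ.^ 2

  instance
    W≢0 : NonZero W
    W≢0 = ∑ℕ-nonZero w w≢0

    2W≢0 : NonZero (2 ℕ.* W)
    2W≢0 = ℕ.m*n≢0 2 W

    2W²≢0 : NonZero (2 ℕ.* W ℕ.^ 2)
    2W²≢0 = ℕ.m*n≢0 2 (W ℕ.^ 2) {{_}} {{ℕ.m^n≢0 W 2}}

    2N≢0 : NonZero (2 ℕ.* N)
    2N≢0 = ℕ.m*n≢0 2 N

  D : ℚ
  D = (+ p ℚ./ (2 ℕ.* W)) ℚ.* (ℕ→ℚ (W ℕ.^ 2) ℚ.- ℕ→ℚ ∑w²)

  -- Taken on costs: Φ(S) is Φ (F S), and Φ* is Φ F*.
  Φ : ℝ → ℝ
  Φ c = c + fromℕ (p ℕ.* W)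

  𝒜 : List ℕ
  𝒜 = map (λ j → r j ℕ.% p) (allFin N)

  R : ℕ → Fin N → ℤ
  R a j = + a ℤ.+ + p ℤ.* ℚ.ceiling ((+ r j ℤ.- + a) ℚ./ p)

  𝒯 : ℕ → ℤ → Set
  𝒯 a t = ∃₂ λ i k → k ℕ.< N × t ≡ R a i ℤ.+ + k ℤ.* + p

  edgeCost : Fin N → ℤ → ℤ
  edgeCost j t = + w j ℤ.* ((t ℤ.+ + p ℤ.- + d j) ℤ.⊔ + 0)

  -- A matching that covers every job, as the function sending a job to its partner.
  record Matching (a : ℕ) : Set where
    field
      time      : Fin N → ℤ
      node      : ∀ j → 𝒯 a (time j)
      edge      : ∀ j → + r j ℤ.≤ time j
      injective : Injective _≡_ _≡_ time

  open Matching public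

  cost : ∀ {a} → Matching a → ℤ
  cost M = ∑ℤ λ j → edgeCost j (time M j)

  private
    OnGrid : ℕ → ℤ → Set
    OnGrid a t = ∃[ c ] t ≡ + a ℤ.+ c ℤ.* + p

    on-grid : ∀ a t → 𝒯 a t → OnGrid a t
    on-grid a t (i , k , _ , eq) = ℚ.ceiling ((+ r i ℤ.- + a) ℚ./ p) ℤ.+ + k , trans eq
      (solve 4 (λ a p c k → (a :+ p :* c) :+ k :* p := a :+ (c :+ k) :* p)
        refl (+ a) (+ p) (ℚ.ceiling ((+ r i ℤ.- + a) ℚ./ p)) (+ k))
      where open ℤ-Solver

    next-slot : ∀ a c c′ → c ℤ.< c′ →
                (+ a ℤ.+ c ℤ.* + p) ℤ.+ + p ℤ.≤ + a ℤ.+ c′ ℤ.* + p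
    next-slot a c c′ c<c′ = subst (ℤ._≤ + a ℤ.+ c′ ℤ.* + p)
      (solve 3 (λ a c p → a :+ (con (+ 1) :+ c) :* p := (a :+ c :* p) :+ p) refl (+ a) c (+ p))
      (ℤ.+-monoʳ-≤ (+ a) (ℤ.*-monoʳ-≤-nonNeg (+ p) (ℤ.i<j⇒suc[i]≤j c<c′)))
      where open ℤ-Solver

    slot-order : ∀ a c c′ {t t′} → t ≡ + a ℤ.+ c ℤ.* + p → t′ ≡ + a ℤ.+ c′ ℤ.* + p →
                 c ℤ.< c′ → t ℤ.+ + p ℤ.≤ t′
    slot-order a c c′ t≡ t′≡ c<c′ =
      subst₂ (λ x y → x ℤ.+ + p ℤ.≤ y) (sym t≡) (sym t′≡) (next-slot a c c′ c<c′)

    apart : ∀ a u v → OnGrid a u → OnGrid a v → u ≢ v → ∀ t →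
            t ∈[ fromℤ u ,+p⟩ → ¬ (t ∈[ fromℤ v ,+p⟩)
    apart a u v (c , u≡) (c′ , v≡) u≢v t (u≤ , <u) (v≤ , <v) = compare (ℤ.<-cmp c c′)
      where
      compare : Tri (c ℤ.< c′) (c ≡ c′) (c′ ℤ.< c) → ⊥
      compare (tri< lt _ _) = slots-disjoint v u p t (slot-order a c c′ u≡ v≡ lt) v≤ <u
      compare (tri> _ _ gt) = slots-disjoint u v p t (slot-order a c′ c v≡ u≡ gt) u≤ <v
      compare (tri≈ _ eq _) =
        u≢v (trans u≡ (trans (cong (λ c → + a ℤ.+ c ℤ.* + p) eq) (sym v≡)))

  schedule : ∀ {a} → Matching a → Schedule
  schedule {a} M = record
    { start    = fromℤ ∘ time M
    ; released = λ j → fromℕ≤fromℤ (r j) (time M j) (edge M j)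
    ; disjoint = λ i j i≢j t (t∈i , t∈j) →
        apart a (time M i) (time M j)
          (on-grid a (time M i) (node M i)) (on-grid a (time M j) (node M j))
          (i≢j ∘ injective M) t t∈i t∈j
    }

  -- The minimum-cost matchings found, with arbitrary tie-breaking; the irrelevant
  -- membership proofs ensure a single matching for each distinct phase.
  record Matchings : Set where
    field
      matching : ∀ a → .(a ∈ 𝒜) → Matching a
      optimal  : ∀ a .(a∈ : a ∈ 𝒜) (M : Matching a) → cost (matching a a∈) ℤ.≤ cost M

    candidate : ∀ a → .(a ∈ 𝒜) → Schedule
    candidate a a∈ = schedule (matching a a∈)

  open Matchings public

  record Run : Set where
    field
      matchings : Matchings
      phase     : ℕ
      phase∈    : phase ∈ 𝒜
      least     : ∀ a .(a∈ : a ∈ 𝒜) →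
                  F (candidate matchings phase phase∈) ≤ F (candidate matchings a a∈)

    S-alg : Schedule
    S-alg = candidate matchings phase phase∈

  open Run public using (S-alg)

{-# OPTIONS --safe #-}
module Submission where

-- Fix a feasible schedule S. Serving the jobs as early as possible in the order of S
-- gives integer starts v ≤ S in which every v j has the form r l + k p with k < N, so that
-- the residues of the v i are phases of the algorithm. Rounding all v j up to the grid of
-- v i keeps them p apart and delays job j by (v i − v j) mod p, which is 0 for j = i. For
-- i ≠ j the two delays (v i − v j) mod p and (v j − v i) mod p add up to at most p. Hence
-- the average of the total weighted delay over i, with weights w i / W, is at most D, and
-- so is the excess of the best phase. As D = (ρ − 1) p W for the claimed ratio ρ, and
-- Φ* ≥ p W, the ratio bound follows.
--
-- The order of the real starts is decidable because distinct starts lie at least p ≥ 1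
-- apart, so that rational approximations of precision 1/8 are in the same order.

open import Defs
open ℝ
import Algebra.Properties.Semiring.Sum
open import Data.Fin.Base using (Fin; zero; suc)
import Data.Fin.Properties as Fin
open import Data.Integer.Base as ℤ using (ℤ; +_)
import Data.Integer.DivMod as ℤ
import Data.Integer.Properties as ℤ
open import Data.Integer.Solver using () renaming (module +-*-Solver to ℤ-Solver)
open import Data.List.Membership.Propositional using (_∈_)
open import Data.List.Membership.Propositional.Properties using (∈-map⁺; ∈-allFin)
open import Data.Nat.Base as ℕ using (ℕ; zero; suc; NonZero)
import Data.Nat.DivMod as ℕ
open import Data.Nat.Induction using (<-wellFounded)
import Data.Nat.Properties as ℕ
open import Data.Nat.Solver using () renaming (module +-*-Solver to ℕ-Solver)
open import Data.Product.Base using (∃-syntax; _×_; _,_; proj₁; proj₂; Σ-syntax)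
open import Data.Rational.Base as ℚ using (ℚ; 0ℚ; 1ℚ; ½; ∣_∣)
import Data.Rational.Properties as ℚ
open import Data.Rational.Solver using () renaming (module +-*-Solver to ℚ-Solver)
import Data.Rational.Unnormalised.Base as ℚᵘ
import Data.Rational.Unnormalised.Properties as ℚᵘ
open import Data.Sum.Base using (_⊎_; inj₁; inj₂)
open import Data.Vec.Functional using (Vector; foldr)
open import Function.Base using (_∘_; _on_)
open import Induction.WellFounded as WF using (WellFounded; WfRec)
open import Relation.Binary.Definitions using (tri<; tri≈; tri>)
import Relation.Binary.Construct.On as On
open import Relation.Binary.PropositionalEquality
open import Relation.Nullary.Decidable.Core using (Dec; yes; no)
open import Relation.Nullary.Negation using (¬_; contradiction)

-- Finite sums

module ∑ℕ = Algebra.Properties.Semiring.Sum ℕ.+-*-semiring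

∑ℕ-mono : ∀ {n} {f g : Vector ℕ n} → (∀ j → f j ℕ.≤ g j) → ∑ℕ f ℕ.≤ ∑ℕ g
∑ℕ-mono {zero}  f≤g = ℕ.z≤n
∑ℕ-mono {suc n} f≤g = ℕ.+-mono-≤ (f≤g zero) (∑ℕ-mono (f≤g ∘ suc))

-- Slack at a single index survives in the sum. It is the diagonal term `p * w i` in the pairing of
-- the delays, and one counted element in the comparison of ranks.
∑ℕ-mono-gap : ∀ {n} {f g : Vector ℕ n} i e → (∀ j → f j ℕ.≤ g j) → f i ℕ.+ e ℕ.≤ g i →
              ∑ℕ f ℕ.+ e ℕ.≤ ∑ℕ g
∑ℕ-mono-gap {suc n} {f} {g} zero e f≤g gap = begin
  f zero ℕ.+ ∑ℕ (f ∘ suc) ℕ.+ e    ≡⟨ solve 3 (λ a s e → a :+ s :+ e := a :+ e :+ s)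
                                        refl (f zero) (∑ℕ (f ∘ suc)) e ⟩
  f zero ℕ.+ e ℕ.+ ∑ℕ (f ∘ suc)    ≤⟨ ℕ.+-mono-≤ gap (∑ℕ-mono (f≤g ∘ suc)) ⟩
  g zero ℕ.+ ∑ℕ (g ∘ suc)          ∎
  where
  open ℕ.≤-Reasoning
  open ℕ-Solver
∑ℕ-mono-gap {suc n} {f} {g} (suc i) e f≤g gap = begin
  f zero ℕ.+ ∑ℕ (f ∘ suc) ℕ.+ e    ≡⟨ ℕ.+-assoc (f zero) _ e ⟩
  f zero ℕ.+ (∑ℕ (f ∘ suc) ℕ.+ e)  ≤⟨ ℕ.+-mono-≤ (f≤g zero) (∑ℕ-mono-gap i e (f≤g ∘ suc) gap) ⟩
  g zero ℕ.+ ∑ℕ (g ∘ suc)          ∎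
  where open ℕ.≤-Reasoning

-- Once the larger number is written as `m + k`, the two sides differ by `k ^ 2`; ordering the
-- arguments first avoids subtraction.
2mn≤m²+n² : ∀ m n → 2 ℕ.* (m ℕ.* n) ℕ.≤ m ℕ.^ 2 ℕ.+ n ℕ.^ 2
2mn≤m²+n² m n = case (ℕ.≤-total m n)
  where
  open ℕ-Solver

  ordered : ∀ {m n} → m ℕ.≤ n → 2 ℕ.* (m ℕ.* n) ℕ.≤ m ℕ.^ 2 ℕ.+ n ℕ.^ 2
  ordered {m} m≤n with k , refl ← ℕ.m≤n⇒∃[o]m+o≡n m≤n =
    ℕ.≤-trans (ℕ.m≤m+n _ (k ℕ.^ 2)) (ℕ.≤-reflexive
      (solve 2 (λ m k → con 2 :* (m :* (m :+ k)) :+ k :^ 2 := m :^ 2 :+ (m :+ k) :^ 2) refl m k))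

  case : m ℕ.≤ n ⊎ n ℕ.≤ m → 2 ℕ.* (m ℕ.* n) ℕ.≤ m ℕ.^ 2 ℕ.+ n ℕ.^ 2
  case (inj₁ m≤n) = ordered m≤n
  case (inj₂ n≤m) = subst₂ ℕ._≤_ (cong (2 ℕ.*_) (ℕ.*-comm n m)) (ℕ.+-comm (n ℕ.^ 2) (m ℕ.^ 2))
    (ordered n≤m)

-- The bound for a pair, added up over all entries of `w`; it handles the cross term in the
-- induction for Cauchy-Schwarz.
2a∑≤na²+∑² : ∀ {n} a (w : Vector ℕ n) →
             2 ℕ.* (a ℕ.* ∑ℕ w) ℕ.≤ n ℕ.* a ℕ.^ 2 ℕ.+ ∑ℕ (λ j → w j ℕ.^ 2)
2a∑≤na²+∑² {zero} a w = ℕ.≤-reflexive (cong (2 ℕ.*_) (ℕ.*-zeroʳ a))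
2a∑≤na²+∑² {suc n} a w = begin
  2 ℕ.* (a ℕ.* (b ℕ.+ S))                        ≡⟨ solve 3 (λ a b s → con 2 :* (a :* (b :+ s)) :=
                                                      con 2 :* (a :* b) :+ con 2 :* (a :* s)) refl a b S ⟩
  2 ℕ.* (a ℕ.* b) ℕ.+ 2 ℕ.* (a ℕ.* S)            ≤⟨ ℕ.+-mono-≤ (2mn≤m²+n² a b) (2a∑≤na²+∑² a (w ∘ suc)) ⟩
  a ℕ.^ 2 ℕ.+ b ℕ.^ 2 ℕ.+ (n ℕ.* a ℕ.^ 2 ℕ.+ Q)  ≡⟨ solve 4 (λ a b x q → a :+ b :+ (x :+ q) :=
                                                      a :+ x :+ (b :+ q)) refl (a ℕ.^ 2) (b ℕ.^ 2) (n ℕ.* a ℕ.^ 2) Q ⟩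
  a ℕ.^ 2 ℕ.+ n ℕ.* a ℕ.^ 2 ℕ.+ (b ℕ.^ 2 ℕ.+ Q)  ∎
  where
  open ℕ.≤-Reasoning
  open ℕ-Solver
  b = w zero
  S = ∑ℕ (w ∘ suc)
  Q = ∑ℕ (λ j → w (suc j) ℕ.^ 2)

-- Cauchy-Schwarz against the constant vector 1. It yields the passage from the weighted ratio to
-- `3/2 - 1/(2N)`.
[∑]²≤n∑² : ∀ {n} (w : Vector ℕ n) → ∑ℕ w ℕ.^ 2 ℕ.≤ n ℕ.* ∑ℕ (λ j → w j ℕ.^ 2)
[∑]²≤n∑² {zero} w = ℕ.z≤n
[∑]²≤n∑² {suc n} w = begin
  (a ℕ.+ S) ℕ.^ 2                                  ≡⟨ solve 2 (λ a s → (a :+ s) :^ 2 :=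
                                                        a :^ 2 :+ con 2 :* (a :* s) :+ s :^ 2) refl a S ⟩
  a ℕ.^ 2 ℕ.+ 2 ℕ.* (a ℕ.* S) ℕ.+ S ℕ.^ 2          ≤⟨ ℕ.+-mono-≤ (ℕ.+-monoʳ-≤ (a ℕ.^ 2)
                                                        (2a∑≤na²+∑² a (w ∘ suc))) ([∑]²≤n∑² (w ∘ suc)) ⟩
  a ℕ.^ 2 ℕ.+ (n ℕ.* a ℕ.^ 2 ℕ.+ Q) ℕ.+ n ℕ.* Q    ≡⟨ solve 3 (λ a q n → a :+ (n :* a :+ q) :+ n :* q :=
                                                        (con 1 :+ n) :* (a :+ q)) refl (a ℕ.^ 2) Q n ⟩
  suc n ℕ.* (a ℕ.^ 2 ℕ.+ Q)                        ∎
  where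
  open ℕ.≤-Reasoning
  open ℕ-Solver
  a = w zero
  S = ∑ℕ (w ∘ suc)
  Q = ∑ℕ (λ j → w (suc j) ℕ.^ 2)

-- The cross terms of the square are nonnegative. Hence `ρ - 1` is nonnegative, so that `p W ≤ Φ*`
-- may be multiplied by it.
∑²≤[∑]² : ∀ {n} (w : Vector ℕ n) → ∑ℕ (λ j → w j ℕ.^ 2) ℕ.≤ ∑ℕ w ℕ.^ 2
∑²≤[∑]² {zero} w = ℕ.z≤n
∑²≤[∑]² {suc n} w = begin
  a ℕ.^ 2 ℕ.+ ∑ℕ (λ j → w (suc j) ℕ.^ 2)        ≤⟨ ℕ.+-monoʳ-≤ (a ℕ.^ 2) (∑²≤[∑]² (w ∘ suc)) ⟩
  a ℕ.^ 2 ℕ.+ S ℕ.^ 2                           ≤⟨ ℕ.m≤m+n _ (2 ℕ.* (a ℕ.* S)) ⟩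
  a ℕ.^ 2 ℕ.+ S ℕ.^ 2 ℕ.+ 2 ℕ.* (a ℕ.* S)       ≡⟨ solve 2 (λ a s → a :^ 2 :+ s :^ 2 :+ con 2 :* (a :* s)
                                                     := (a :+ s) :^ 2) refl a S ⟩
  (a ℕ.+ S) ℕ.^ 2                               ∎
  where
  open ℕ.≤-Reasoning
  open ℕ-Solver
  a = w zero
  S = ∑ℕ (w ∘ suc)

-- Exchanging the two summations pairs δ i j with δ j i.
∑∑-pairing : ∀ {n} p (w : Vector ℕ n) (δ : Fin n → Fin n → ℕ) →
             (∀ i j → δ i j ℕ.+ δ j i ℕ.≤ p) → (∀ i → δ i i ≡ 0) →
             2 ℕ.* ∑ℕ (λ i → w i ℕ.* ∑ℕ λ j → w j ℕ.* δ i j) ℕ.+ p ℕ.* ∑ℕ (λ j → w j ℕ.^ 2)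
               ℕ.≤ p ℕ.* ∑ℕ w ℕ.^ 2
∑∑-pairing p w δ pair diag = begin
  2 ℕ.* ∑ℕ f ℕ.+ p ℕ.* ∑ℕ (λ j → w j ℕ.^ 2)
    ≡⟨ cong₂ (λ x y → ∑ℕ f ℕ.+ x ℕ.+ y) (trans (ℕ.+-identityʳ (∑ℕ f)) exchange)
         (∑ℕ.*-distribˡ-sum p (λ j → w j ℕ.^ 2)) ⟩
  ∑ℕ f ℕ.+ ∑ℕ g ℕ.+ ∑ℕ h
    ≡⟨ cong (ℕ._+ ∑ℕ h) (∑ℕ.∑-distrib-+ f g) ⟨
  ∑ℕ (λ i → f i ℕ.+ g i) ℕ.+ ∑ℕ h
    ≡⟨ ∑ℕ.∑-distrib-+ (λ i → f i ℕ.+ g i) h ⟨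
  ∑ℕ (λ i → f i ℕ.+ g i ℕ.+ h i)
    ≤⟨ ∑ℕ-mono weighted-cross ⟩
  ∑ℕ (λ i → w i ℕ.* (p ℕ.* ∑ℕ w))
    ≡⟨ ∑ℕ.*-distribʳ-sum (p ℕ.* ∑ℕ w) w ⟨
  ∑ℕ w ℕ.* (p ℕ.* ∑ℕ w)
    ≡⟨ solve 2 (λ p s → s :* (p :* s) := p :* s :^ 2) refl p (∑ℕ w) ⟩
  p ℕ.* ∑ℕ w ℕ.^ 2 ∎
  where
  open ℕ.≤-Reasoning
  open ℕ-Solver

  row column : Fin _ → ℕ
  row    i = ∑ℕ λ j → w j ℕ.* δ i j
  column i = ∑ℕ λ j → w j ℕ.* δ j i

  f g h : Fin _ → ℕ
  f i = w i ℕ.* row i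
  g i = w i ℕ.* column i
  h i = p ℕ.* w i ℕ.^ 2

  exchange : ∑ℕ f ≡ ∑ℕ g
  exchange = begin-equality
    ∑ℕ f
      ≡⟨ ∑ℕ.sum-cong-≗ (λ i → ∑ℕ.*-distribˡ-sum (w i) (λ j → w j ℕ.* δ i j)) ⟩
    ∑ℕ (λ i → ∑ℕ λ j → w i ℕ.* (w j ℕ.* δ i j))
      ≡⟨ ∑ℕ.∑-comm (λ i j → w i ℕ.* (w j ℕ.* δ i j)) ⟩
    ∑ℕ (λ j → ∑ℕ λ i → w i ℕ.* (w j ℕ.* δ i j))
      ≡⟨ ∑ℕ.sum-cong-≗ (λ j → ∑ℕ.sum-cong-≗ λ i →
           solve 3 (λ a b d → a :* (b :* d) := b :* (a :* d)) refl (w i) (w j) (δ i j)) ⟩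
    ∑ℕ (λ j → ∑ℕ λ i → w j ℕ.* (w i ℕ.* δ i j))
      ≡⟨ ∑ℕ.sum-cong-≗ (λ j → ∑ℕ.*-distribˡ-sum (w j) (λ i → w i ℕ.* δ i j)) ⟨
    ∑ℕ g ∎

  cross : ∀ i → row i ℕ.+ column i ℕ.+ p ℕ.* w i ℕ.≤ p ℕ.* ∑ℕ w
  cross i = begin
    row i ℕ.+ column i ℕ.+ p ℕ.* w i
      ≡⟨ cong (ℕ._+ p ℕ.* w i) (∑ℕ.∑-distrib-+ (λ j → w j ℕ.* δ i j) (λ j → w j ℕ.* δ j i)) ⟨
    ∑ℕ (λ j → w j ℕ.* δ i j ℕ.+ w j ℕ.* δ j i) ℕ.+ p ℕ.* w i
      -- The zero diagonal leaves a slack of `p * w i` at index `i`; multiplied by `w i` and summed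
      -- over `i`, it becomes the term with the squares.
      ≤⟨ ∑ℕ-mono-gap i (p ℕ.* w i) off-diagonal on-diagonal ⟩
    ∑ℕ (λ j → p ℕ.* w j)
      ≡⟨ ∑ℕ.*-distribˡ-sum p w ⟨
    p ℕ.* ∑ℕ w ∎
    where
    off-diagonal : ∀ j → w j ℕ.* δ i j ℕ.+ w j ℕ.* δ j i ℕ.≤ p ℕ.* w j
    off-diagonal j = begin
      w j ℕ.* δ i j ℕ.+ w j ℕ.* δ j i  ≡⟨ ℕ.*-distribˡ-+ (w j) (δ i j) (δ j i) ⟨
      w j ℕ.* (δ i j ℕ.+ δ j i)        ≤⟨ ℕ.*-monoʳ-≤ (w j) (pair i j) ⟩
      w j ℕ.* p                        ≡⟨ ℕ.*-comm (w j) p ⟩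
      p ℕ.* w j                        ∎

    on-diagonal : w i ℕ.* δ i i ℕ.+ w i ℕ.* δ i i ℕ.+ p ℕ.* w i ℕ.≤ p ℕ.* w i
    on-diagonal rewrite diag i | ℕ.*-zeroʳ (w i) = ℕ.≤-refl

  weighted-cross : ∀ i → f i ℕ.+ g i ℕ.+ h i ℕ.≤ w i ℕ.* (p ℕ.* ∑ℕ w)
  weighted-cross i = begin
    w i ℕ.* row i ℕ.+ w i ℕ.* column i ℕ.+ p ℕ.* w i ℕ.^ 2
      ≡⟨ solve 4 (λ a r c p → a :* r :+ a :* c :+ p :* a :^ 2 := a :* (r :+ c :+ p :* a))
           refl (w i) (row i) (column i) p ⟩
    w i ℕ.* (row i ℕ.+ column i ℕ.+ p ℕ.* w i)
      ≤⟨ ℕ.*-monoʳ-≤ (w i) (cross i) ⟩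
    w i ℕ.* (p ℕ.* ∑ℕ w) ∎

∑ℤ-mono-+ : ∀ {n} {f g : Vector ℤ n} {h : Vector ℕ n} → (∀ j → f j ℤ.≤ g j ℤ.+ + h j) →
            ∑ℤ f ℤ.≤ ∑ℤ g ℤ.+ + ∑ℕ h
∑ℤ-mono-+ {zero} f≤ = ℤ.≤-refl
∑ℤ-mono-+ {suc n} {f} {g} {h} f≤ = ℤ.≤-trans (ℤ.+-mono-≤ (f≤ zero) (∑ℤ-mono-+ (f≤ ∘ suc)))
  (ℤ.≤-reflexive (solve 4 (λ a b c d → a :+ b :+ (c :+ d) := a :+ c :+ (b :+ d)) refl
    (g zero) (+ h zero) (∑ℤ (g ∘ suc)) (+ ∑ℕ (h ∘ suc))))
  where open ℤ-Solver

-- A number below every `G + Δ i` is below their weighted average. Multiplying by the total weight,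
-- instead of dividing, keeps the statement in ℤ.
weighted-average : ∀ {n} (w Δ : Vector ℕ n) (c G : ℤ) → (∀ i → c ℤ.≤ G ℤ.+ + Δ i) →
                   + ∑ℕ w ℤ.* c ℤ.≤ + ∑ℕ w ℤ.* G ℤ.+ + ∑ℕ (λ i → w i ℕ.* Δ i)
weighted-average {zero} w Δ c G c≤ = ℤ.≤-refl
weighted-average {suc n} w Δ c G c≤ = begin
  + (a ℕ.+ A) ℤ.* c                            ≡⟨ ℤ.*-distribʳ-+ c (+ a) (+ A) ⟩
  + a ℤ.* c ℤ.+ + A ℤ.* c                      ≤⟨ ℤ.+-mono-≤ (ℤ.*-monoˡ-≤-nonNeg (+ a) (c≤ zero))
                                                    (weighted-average (w ∘ suc) (Δ ∘ suc) c G (c≤ ∘ suc)) ⟩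
  + a ℤ.* (G ℤ.+ + d) ℤ.+ (+ A ℤ.* G ℤ.+ + E)  ≡⟨ solve 5 (λ a g d b e → a :* (g :+ d) :+ (b :* g :+ e)
                                                    := (a :+ b) :* g :+ (a :* d :+ e)) refl (+ a) G (+ d) (+ A) (+ E) ⟩
  + (a ℕ.+ A) ℤ.* G ℤ.+ (+ a ℤ.* + d ℤ.+ + E)  ≡⟨ cong (λ z → + (a ℕ.+ A) ℤ.* G ℤ.+ (z ℤ.+ + E)) (ℤ.pos-* a d) ⟨
  + (a ℕ.+ A) ℤ.* G ℤ.+ + (a ℕ.* d ℕ.+ E)      ∎
  where
  open ℤ.≤-Reasoning
  open ℤ-Solver
  a = w zero
  d = Δ zero
  A = ∑ℕ (w ∘ suc)
  E = ∑ℕ (λ i → w (suc i) ℕ.* Δ (suc i))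

-- Left-shifted schedules

maximum : ∀ {n} → Vector ℕ n → ℕ
maximum = foldr ℕ._⊔_ 0

≤maximum : ∀ {n} (f : Vector ℕ n) i → f i ℕ.≤ maximum f
≤maximum f zero    = ℕ.m≤m⊔n (f zero) _
≤maximum f (suc i) = ℕ.≤-trans (≤maximum (f ∘ suc) i) (ℕ.m≤n⊔m (f zero) _)

maximum-sel : ∀ {n} (f : Vector ℕ n) → maximum f ≡ 0 ⊎ ∃[ i ] maximum f ≡ f i
maximum-sel {zero}  f = inj₁ refl
maximum-sel {suc n} f with ℕ.⊔-sel (f zero) (maximum (f ∘ suc)) | maximum-sel (f ∘ suc)
... | inj₁ eq | _             = inj₂ (zero , eq)
... | inj₂ eq | inj₁ eq′      = inj₁ (trans eq eq′)
... | inj₂ eq | inj₂ (i , eq′) = inj₂ (suc i , trans eq eq′)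

maximum-cong : ∀ {n} {f g : Vector ℕ n} → (∀ i → f i ≡ g i) → maximum f ≡ maximum g
maximum-cong {zero}  f≗g = refl
maximum-cong {suc n} f≗g = cong₂ ℕ._⊔_ (f≗g zero) (maximum-cong (f≗g ∘ suc))

module LeftShift {n} (p : ℕ) (r rank : Fin n → ℕ) where

  _≺_ : Fin n → Fin n → Set
  _≺_ = ℕ._<_ on rank

  ≺-wellFounded : WellFounded _≺_
  ≺-wellFounded = On.wellFounded rank <-wellFounded

  -- The default 0 is neutral for maxima of natural numbers, so `earliest` can range over all `i`
  -- without filtering out those that do not precede `j`.
  completion : ∀ i j → Dec (i ≺ j) → WfRec _≺_ (λ _ → ℕ) j → ℕ
  completion i j (yes i≺j) v = v i≺j ℕ.+ p
  completion i j (no  _)   v = 0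

  earliest : ∀ j → WfRec _≺_ (λ _ → ℕ) j → ℕ
  earliest j v = r j ℕ.⊔ maximum (λ i → completion i j (rank i ℕ.<? rank j) v)

  -- The extensionality condition under which well-founded recursion satisfies its unfolding
  -- equation `v-unfold`.
  earliest-ext : ∀ j {v v′ : WfRec _≺_ (λ _ → ℕ) j} →
                 (∀ {i} (i≺j : i ≺ j) → v i≺j ≡ v′ i≺j) → earliest j v ≡ earliest j v′
  earliest-ext j {v} {v′} v≗v′ =
    cong (r j ℕ.⊔_) (maximum-cong λ i → completion-ext i (rank i ℕ.<? rank j))
    where
    completion-ext : ∀ i d → completion i j d v ≡ completion i j d v′
    completion-ext i (yes i≺j) = cong (ℕ._+ p) (v≗v′ i≺j)
    completion-ext i (no  _)   = refl

  -- Opaque, so that the well-founded recursion is never normalised.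
  opaque
    v : Fin n → ℕ
    v = WF.All.wfRec ≺-wellFounded _ (λ _ → ℕ) earliest

    v-unfold : ∀ j → v j ≡ earliest j (λ {i} _ → v i)
    v-unfold j = WF.FixPoint.unfold-wfRec ≺-wellFounded (λ _ → ℕ) earliest earliest-ext

  predecessor : Fin n → Fin n → ℕ
  predecessor j i = completion i j (rank i ℕ.<? rank j) λ {i} _ → v i

  r≤v : ∀ j → r j ℕ.≤ v j
  r≤v j rewrite v-unfold j = ℕ.m≤m⊔n (r j) _

  v+p≤v : ∀ {i j} → i ≺ j → v i ℕ.+ p ℕ.≤ v j
  v+p≤v {i} {j} i≺j rewrite v-unfold j = ℕ.≤-trans (completed (rank i ℕ.<? rank j) refl)
    (ℕ.≤-trans (≤maximum (predecessor j) i) (ℕ.m≤n⊔m (r j) _))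
    where
    completed : ∀ d → (rank i ℕ.<? rank j) ≡ d → v i ℕ.+ p ℕ.≤ predecessor j i
    completed (yes _) eq rewrite eq = ℕ.≤-refl
    completed (no ¬≺) _             = contradiction i≺j ¬≺

  -- A maximum is attained: by the release date, by the completion of a predecessor, or by the
  -- default 0, in which case the release date is attained as well.
  v-tight : ∀ j → v j ≡ r j ⊎ ∃[ i ] i ≺ j × v j ≡ v i ℕ.+ p
  v-tight j with ℕ.⊔-sel (r j) (maximum (predecessor j)) | maximum-sel (predecessor j)
  ... | inj₁ eq | _        = inj₁ (trans (v-unfold j) eq)
  ... | inj₂ eq | inj₁ eq′ = inj₁ (trans (v-unfold j)
    (trans (cong (r j ℕ.⊔_) eq′) (ℕ.⊔-identityʳ (r j))))
  ... | inj₂ eq | inj₂ (i , eq′) with rank i ℕ.<? rank j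
  ...   | yes i≺j = inj₂ (i , i≺j , trans (v-unfold j) (trans eq eq′))
  ...   | no  _   = inj₁ (trans (v-unfold j) (trans (cong (r j ℕ.⊔_) eq′) (ℕ.⊔-identityʳ (r j))))

  -- Tight predecessors are followed back to a job that starts at its release date. Each step adds
  -- `p` and the rank drops strictly, so there are at most `rank j` steps.
  v-chain : ∀ j → ∃[ i ] ∃[ k ] k ℕ.≤ rank j × v j ≡ r i ℕ.+ k ℕ.* p
  v-chain = WF.All.wfRec ≺-wellFounded _ _ chain
    where
    open ℕ.≤-Reasoning
    chain : ∀ j → WfRec _≺_ (λ j → ∃[ i ] ∃[ k ] k ℕ.≤ rank j × v j ≡ r i ℕ.+ k ℕ.* p) j → _
    chain j IH with v-tight j
    ... | inj₁ eq = j , 0 , ℕ.z≤n , trans eq (sym (ℕ.+-identityʳ (r j)))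
    ... | inj₂ (i , i≺j , eq) with l , k , k≤ , eq′ ← IH i≺j =
      l , suc k , ℕ.≤-trans (ℕ.s≤s k≤) i≺j , (begin-equality
        v j                        ≡⟨ eq ⟩
        v i ℕ.+ p                  ≡⟨ cong (ℕ._+ p) eq′ ⟩
        r l ℕ.+ k ℕ.* p ℕ.+ p      ≡⟨ ℕ.+-assoc (r l) _ p ⟩
        r l ℕ.+ (k ℕ.* p ℕ.+ p)    ≡⟨ cong (r l ℕ.+_) (ℕ.+-comm (k ℕ.* p) p) ⟩
        r l ℕ.+ suc k ℕ.* p        ∎)

-- Ceilings and remainders

floor-bounds : ∀ q → ℚ.floor q ℤ.* ℚ.↧ q ℤ.≤ ℚ.↥ q × ℚ.↥ q ℤ.< ℤ.suc (ℚ.floor q) ℤ.* ℚ.↧ q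
floor-bounds q@record{} =
  ℤ.[n/d]*d≤n (ℚ.↥ q) (ℚ.↧ q) ,
  subst (λ x → ℚ.↥ q ℤ.< ℤ.suc x ℤ.* ℚ.↧ q) (sym (ℤ.div-pos-is-/ℕ (ℚ.↥ q) (ℚ.↧ₙ q)))
    (ℤ.n<s[n/ℕd]*d (ℚ.↥ q) (ℚ.↧ₙ q))

-- The ceiling is the negated floor of the negation. As `z / p` is stored in lowest terms, the
-- bounds hold for the reduced denominator first and are carried over to `p` by
-- cross-multiplication.
ceiling-bounds : ∀ z p .{{_ : NonZero p}} → let c = ℚ.ceiling (z ℚ./ p) in
                 z ℤ.≤ c ℤ.* + p × c ℤ.* + p ℤ.< z ℤ.+ + p
ceiling-bounds z p@(suc _) = bounds (z ℚ./ p) (fraction (ℚ.toℚᵘ-fromℚᵘ (ℚᵘ.mkℚᵘ z (ℕ.pred p))))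
  where
  open ℤ-Solver

  fraction : ∀ {q} → ℚ.toℚᵘ q ℚᵘ.≃ ℚᵘ.mkℚᵘ z (ℕ.pred p) → ℚ.↥ q ℤ.* + p ≡ z ℤ.* ℚ.↧ q
  fraction {record{}} (ℚᵘ.*≡* eq) = eq

  bounds : ∀ q → ℚ.↥ q ℤ.* + p ≡ z ℤ.* ℚ.↧ q →
           z ℤ.≤ ℚ.ceiling q ℤ.* + p × ℚ.ceiling q ℤ.* + p ℤ.< z ℤ.+ + p
  bounds q@record{} eq = lower , upper
    where
    open ℤ.≤-Reasoning
    f = ℚ.floor (ℚ.- q)
    d = ℚ.↧ q
    n = ℚ.↥ q

    f-lower : f ℤ.* d ℤ.≤ ℤ.- n
    f-lower = subst₂ (λ a b → f ℤ.* a ℤ.≤ b) (ℚ.↧-neg q) (ℚ.↥-neg q) (proj₁ (floor-bounds (ℚ.- q)))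

    f-upper : ℤ.- n ℤ.< ℤ.suc f ℤ.* d
    f-upper = subst₂ (λ a b → b ℤ.< ℤ.suc f ℤ.* a) (ℚ.↧-neg q) (ℚ.↥-neg q) (proj₂ (floor-bounds (ℚ.- q)))

    lower : z ℤ.≤ ℤ.- f ℤ.* + p
    lower = ℤ.*-cancelʳ-≤-pos z (ℤ.- f ℤ.* + p) d (begin
      z ℤ.* d                     ≡⟨ eq ⟨
      n ℤ.* + p                   ≡⟨ solve 2 (λ n p → n :* p := :- (:- n :* p)) refl n (+ p) ⟩
      ℤ.- (ℤ.- n ℤ.* + p)         ≤⟨ ℤ.neg-mono-≤ (ℤ.*-monoʳ-≤-nonNeg (+ p) f-lower) ⟩
      ℤ.- (f ℤ.* d ℤ.* + p)       ≡⟨ solve 3 (λ f d p → :- (f :* d :* p) := :- f :* p :* d) refl f d (+ p) ⟩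
      ℤ.- f ℤ.* + p ℤ.* d         ∎)

    upper : ℤ.- f ℤ.* + p ℤ.< z ℤ.+ + p
    upper = ℤ.*-cancelʳ-<-nonNeg {ℤ.- f ℤ.* + p} {z ℤ.+ + p} d (begin-strict
      ℤ.- f ℤ.* + p ℤ.* d                          ≡⟨ solve 3 (λ f d p → :- f :* p :* d :=
                                                        d :* p :- (con (+ 1) :+ f) :* d :* p) refl f d (+ p) ⟩
      d ℤ.* + p ℤ.- ℤ.suc f ℤ.* d ℤ.* + p          <⟨ ℤ.+-monoʳ-< (d ℤ.* + p)
                                                        (ℤ.neg-mono-< (ℤ.*-monoʳ-<-pos (+ p) f-upper)) ⟩
      d ℤ.* + p ℤ.- (ℤ.- n ℤ.* + p)                ≡⟨ solve 3 (λ n d p → d :* p :- (:- n :* p) := n :* p :+ p :* d)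
                                                        refl n d (+ p) ⟩
      n ℤ.* + p ℤ.+ + p ℤ.* d                      ≡⟨ cong (ℤ._+ + p ℤ.* d) eq ⟩
      z ℤ.* d ℤ.+ + p ℤ.* d                        ≡⟨ ℤ.*-distribʳ-+ d z (+ p) ⟨
      (z ℤ.+ + p) ℤ.* d                            ∎)

-- Two multiples of p that both lie in [ z , z + p ) coincide.
ceiling-unique : ∀ z p .{{_ : NonZero p}} c → z ℤ.≤ c ℤ.* + p → c ℤ.* + p ℤ.< z ℤ.+ + p →
                 ℚ.ceiling (z ℚ./ p) ≡ c
ceiling-unique z p@(suc _) c z≤ <z+p with c≥ , c< ← ceiling-bounds z p =
  ℤ.≤-antisym (below _ c c< z≤) (below c _ <z+p c≥)
  where
  open ℤ.≤-Reasoning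
  below : ∀ a b → a ℤ.* + p ℤ.< z ℤ.+ + p → z ℤ.≤ b ℤ.* + p → a ℤ.≤ b
  below a b a< ≤b = subst (a ℤ.≤_) (ℤ.pred-suc b) (ℤ.i<j⇒i≤pred[j] (ℤ.*-cancelʳ-<-nonNeg {a} {ℤ.suc b} (+ p) (begin-strict
    a ℤ.* + p              <⟨ a< ⟩
    z ℤ.+ + p              ≤⟨ ℤ.+-monoˡ-≤ (+ p) ≤b ⟩
    b ℤ.* + p ℤ.+ + p      ≡⟨ ℤ.+-comm (b ℤ.* + p) (+ p) ⟩
    + p ℤ.+ b ℤ.* + p      ≡⟨ ℤ.suc-* b (+ p) ⟨
    ℤ.suc b ℤ.* + p        ∎)))

-- Since `x` and `- x` cancel, the two remainders add up to a multiple of `p`; each being less than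
-- `p`, the factor `c` is less than 2.
%ℕ+neg%ℕ≤ : ∀ x p .{{_ : NonZero p}} → x ℤ.%ℕ p ℕ.+ (ℤ.- x) ℤ.%ℕ p ℕ.≤ p
%ℕ+neg%ℕ≤ x p = ℤ.drop‿+≤+ (begin
  + (a ℕ.+ b)            ≡⟨ a+b≡cp ⟩
  c ℤ.* + p              ≤⟨ ℤ.*-monoʳ-≤-nonNeg (+ p) c≤1 ⟩
  + 1 ℤ.* + p            ≡⟨ ℤ.*-identityˡ (+ p) ⟩
  + p                    ∎)
  where
  open ℤ.≤-Reasoning
  open ℤ-Solver
  a = x ℤ.%ℕ p
  b = (ℤ.- x) ℤ.%ℕ p
  c = ℤ.- (x ℤ./ℕ p ℤ.+ (ℤ.- x) ℤ./ℕ p)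

  a+b≡cp : + (a ℕ.+ b) ≡ c ℤ.* + p
  a+b≡cp = begin-equality
    + a ℤ.+ + b
      ≡⟨ solve 5 (λ a b s t p → a :+ b := (a :+ s :* p) :+ (b :+ t :* p) :+ :- (s :+ t) :* p) refl
           (+ a) (+ b) (x ℤ./ℕ p) ((ℤ.- x) ℤ./ℕ p) (+ p) ⟩
    (+ a ℤ.+ x ℤ./ℕ p ℤ.* + p) ℤ.+ (+ b ℤ.+ (ℤ.- x) ℤ./ℕ p ℤ.* + p) ℤ.+ c ℤ.* + p
      ≡⟨ cong₂ (λ s t → s ℤ.+ t ℤ.+ c ℤ.* + p) (ℤ.a≡a%ℕn+[a/ℕn]*n x p) (ℤ.a≡a%ℕn+[a/ℕn]*n (ℤ.- x) p) ⟨
    x ℤ.- x ℤ.+ c ℤ.* + p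
      ≡⟨ cong (ℤ._+ c ℤ.* + p) (ℤ.+-inverseʳ x) ⟩
    + 0 ℤ.+ c ℤ.* + p
      ≡⟨ ℤ.+-identityˡ (c ℤ.* + p) ⟩
    c ℤ.* + p ∎

  c≤1 : c ℤ.≤ + 1
  c≤1 = ℤ.i<j⇒i≤pred[j] (ℤ.*-cancelʳ-<-nonNeg {c} {+ 2} (+ p) (begin-strict
    c ℤ.* + p        ≡⟨ a+b≡cp ⟨
    + (a ℕ.+ b)      <⟨ ℤ.+<+ (ℕ.+-mono-< (ℤ.n%ℕd<d x p) (ℤ.n%ℕd<d (ℤ.- x) p)) ⟩
    + (p ℕ.+ p)      ≡⟨ solve 1 (λ p → p :+ p := con (+ 2) :* p) refl (+ p) ⟩
    + 2 ℤ.* + p      ∎))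

0%ℕ≡0 : ∀ p .{{_ : NonZero p}} → (+ 0) ℤ.%ℕ p ≡ 0
0%ℕ≡0 (suc _) = refl

-- Rationals and reals

toℚᵘ-/ : ∀ z n .{{_ : NonZero n}} → ℚ.toℚᵘ (z ℚ./ n) ℚᵘ.≃ z ℚᵘ./ n
toℚᵘ-/ z (suc n) = ℚ.toℚᵘ-fromℚᵘ (ℚᵘ.mkℚᵘ z n)

/1-+ : ∀ a b → (a ℤ.+ b) ℚ./ 1 ≡ a ℚ./ 1 ℚ.+ b ℚ./ 1
/1-+ a b = ℚ.toℚᵘ-injective (begin
  ℚ.toℚᵘ ((a ℤ.+ b) ℚ./ 1)                 ≈⟨ toℚᵘ-/ (a ℤ.+ b) 1 ⟩
  (a ℤ.+ b) ℚᵘ./ 1                         ≈⟨ ℚᵘ.*≡* (cong (ℤ._* + 1) (cong₂ ℤ._+_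
                                               (sym (ℤ.*-identityʳ a)) (sym (ℤ.*-identityʳ b)))) ⟩
  a ℚᵘ./ 1 ℚᵘ.+ b ℚᵘ./ 1                   ≈⟨ ℚᵘ.+-cong (toℚᵘ-/ a 1) (toℚᵘ-/ b 1) ⟨
  ℚ.toℚᵘ (a ℚ./ 1) ℚᵘ.+ ℚ.toℚᵘ (b ℚ./ 1)   ≈⟨ ℚ.toℚᵘ-homo-+ (a ℚ./ 1) (b ℚ./ 1) ⟨
  ℚ.toℚᵘ (a ℚ./ 1 ℚ.+ b ℚ./ 1)             ∎)
  where open ℚᵘ.≃-Reasoning

/1-* : ∀ a b → (a ℤ.* b) ℚ./ 1 ≡ a ℚ./ 1 ℚ.* (b ℚ./ 1)
/1-* a b = ℚ.toℚᵘ-injective (begin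
  ℚ.toℚᵘ ((a ℤ.* b) ℚ./ 1)                 ≈⟨ toℚᵘ-/ (a ℤ.* b) 1 ⟩
  (a ℚᵘ./ 1) ℚᵘ.* (b ℚᵘ./ 1)               ≈⟨ ℚᵘ.*-cong (toℚᵘ-/ a 1) (toℚᵘ-/ b 1) ⟨
  ℚ.toℚᵘ (a ℚ./ 1) ℚᵘ.* ℚ.toℚᵘ (b ℚ./ 1)   ≈⟨ ℚ.toℚᵘ-homo-* (a ℚ./ 1) (b ℚ./ 1) ⟨
  ℚ.toℚᵘ (a ℚ./ 1 ℚ.* (b ℚ./ 1))           ∎)
  where open ℚᵘ.≃-Reasoning

/1-neg : ∀ a → (ℤ.- a) ℚ./ 1 ≡ ℚ.- (a ℚ./ 1)
/1-neg a = ℚ.toℚᵘ-injective (begin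
  ℚ.toℚᵘ ((ℤ.- a) ℚ./ 1)   ≈⟨ toℚᵘ-/ (ℤ.- a) 1 ⟩
  ℚᵘ.- (a ℚᵘ./ 1)          ≈⟨ ℚᵘ.-‿cong (toℚᵘ-/ a 1) ⟨
  ℚᵘ.- ℚ.toℚᵘ (a ℚ./ 1)    ≈⟨ ℚ.toℚᵘ-homo‿- (a ℚ./ 1) ⟨
  ℚ.toℚᵘ (ℚ.- (a ℚ./ 1))   ∎)
  where open ℚᵘ.≃-Reasoning

/-*-cancel : ∀ a n .{{_ : NonZero n}} → (a ℚ./ n) ℚ.* ℕ→ℚ n ≡ a ℚ./ 1
/-*-cancel a n@(suc _) = ℚ.toℚᵘ-injective (begin
  ℚ.toℚᵘ ((a ℚ./ n) ℚ.* ℕ→ℚ n)             ≈⟨ ℚ.toℚᵘ-homo-* (a ℚ./ n) (ℕ→ℚ n) ⟩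
  ℚ.toℚᵘ (a ℚ./ n) ℚᵘ.* ℚ.toℚᵘ (ℕ→ℚ n)     ≈⟨ ℚᵘ.*-cong (toℚᵘ-/ a n) (toℚᵘ-/ (+ n) 1) ⟩
  (a ℚᵘ./ n) ℚᵘ.* (+ n ℚᵘ./ 1)             ≈⟨ ℚᵘ.*≡* (trans (ℤ.*-identityʳ (a ℤ.* + n))
                                               (cong (λ m → a ℤ.* + m) (sym (ℕ.*-identityʳ n)))) ⟩
  a ℚᵘ./ 1                                 ≈⟨ toℚᵘ-/ a 1 ⟨
  ℚ.toℚᵘ (a ℚ./ 1)                         ∎)
  where open ℚᵘ.≃-Reasoning

/-mono-≤ : ∀ a m b n .{{_ : NonZero m}} .{{_ : NonZero n}} →
           a ℤ.* + n ℤ.≤ b ℤ.* + m → a ℚ./ m ℚ.≤ b ℚ./ n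
/-mono-≤ a m@(suc _) b n@(suc _) an≤bm = ℚ.toℚᵘ-cancel-≤ (begin
  ℚ.toℚᵘ (a ℚ./ m)   ≃⟨ toℚᵘ-/ a m ⟩
  a ℚᵘ./ m           ≤⟨ ℚᵘ.*≤* an≤bm ⟩
  b ℚᵘ./ n           ≃⟨ toℚᵘ-/ b n ⟨
  ℚ.toℚᵘ (b ℚ./ n)   ∎)
  where open ℚᵘ.≤-Reasoning

ℕ/-mono-≤ : ∀ a m b n .{{_ : NonZero m}} .{{_ : NonZero n}} →
            a ℕ.* n ℕ.≤ b ℕ.* m → + a ℚ./ m ℚ.≤ + b ℚ./ n
ℕ/-mono-≤ a m b n an≤bm =
  /-mono-≤ (+ a) m (+ b) n (subst₂ ℤ._≤_ (ℤ.pos-* a n) (ℤ.pos-* b m) (ℤ.+≤+ an≤bm))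

/1-mono-≤ : ∀ {a b} → a ℤ.≤ b → a ℚ./ 1 ℚ.≤ b ℚ./ 1
/1-mono-≤ {a} {b} a≤b = /-mono-≤ a 1 b 1 (ℤ.*-monoʳ-≤-nonNeg (+ 1) a≤b)

/1-cancel-≤ : ∀ {a b} → a ℚ./ 1 ℚ.≤ b ℚ./ 1 → a ℤ.≤ b
/1-cancel-≤ {a} {b} a≤b = ℤ.*-cancelʳ-≤-pos a b (+ 1) (ℚᵘ.drop-*≤* (begin
  a ℚᵘ./ 1           ≃⟨ toℚᵘ-/ a 1 ⟨
  ℚ.toℚᵘ (a ℚ./ 1)   ≤⟨ ℚ.toℚᵘ-mono-≤ a≤b ⟩
  ℚ.toℚᵘ (b ℚ./ 1)   ≃⟨ toℚᵘ-/ b 1 ⟩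
  b ℚᵘ./ 1           ∎))
  where open ℚᵘ.≤-Reasoning

/1-⊔ : ∀ a b → (a ℤ.⊔ b) ℚ./ 1 ≡ a ℚ./ 1 ℚ.⊔ b ℚ./ 1
/1-⊔ a b with ℤ.≤-total a b
... | inj₁ a≤b = trans (cong (ℚ._/ 1) (ℤ.i≤j⇒i⊔j≡j a≤b)) (sym (ℚ.p≤q⇒p⊔q≡q (/1-mono-≤ a≤b)))
... | inj₂ b≤a = trans (cong (ℚ._/ 1) (ℤ.i≥j⇒i⊔j≡i b≤a)) (sym (ℚ.p≥q⇒p⊔q≡p (/1-mono-≤ b≤a)))

ℕ→ℚ-mono-≤ : ∀ {m n} → m ℕ.≤ n → ℕ→ℚ m ℚ.≤ ℕ→ℚ n
ℕ→ℚ-mono-≤ m≤n = /1-mono-≤ (ℤ.+≤+ m≤n)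

ℕ→ℚ-* : ∀ m n → ℕ→ℚ (m ℕ.* n) ≡ ℕ→ℚ m ℚ.* ℕ→ℚ n
ℕ→ℚ-* m n = trans (cong (ℚ._/ 1) (ℤ.pos-* m n)) (/1-* (+ m) (+ n))

0<ℕ→ℚ : ∀ n {{_ : NonZero n}} → 0ℚ ℚ.< ℕ→ℚ n
0<ℕ→ℚ n = ℚ.<-≤-trans (ℚ.positive⁻¹ 1ℚ) (ℕ→ℚ-mono-≤ (ℕ.>-nonZero⁻¹ n))

p≤q+∣p-q∣ : ∀ p q → p ℚ.≤ q ℚ.+ ∣ p ℚ.- q ∣
p≤q+∣p-q∣ p q = begin
  p                      ≡⟨ solve 2 (λ p q → p := q :+ (p :- q)) refl p q ⟩
  q ℚ.+ (p ℚ.- q)        ≤⟨ ℚ.+-monoʳ-≤ q (≤∣∣ (p ℚ.- q)) ⟩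
  q ℚ.+ ∣ p ℚ.- q ∣      ∎
  where
  open ℚ.≤-Reasoning
  open ℚ-Solver
  ≤∣∣ : ∀ r → r ℚ.≤ ∣ r ∣
  ≤∣∣ r with ℚ.≤-total 0ℚ r
  ... | inj₁ 0≤r = ℚ.≤-reflexive (sym (ℚ.0≤p⇒∣p∣≡p 0≤r))
  ... | inj₂ r≤0 = ℚ.≤-trans r≤0 (ℚ.0≤∣p∣ r)

*-pos : ∀ {p q} → 0ℚ ℚ.< p → 0ℚ ℚ.< q → 0ℚ ℚ.< p ℚ.* q
*-pos {p} {q} p>0 q>0 = ℚ.positive⁻¹ (p ℚ.* q)
  {{ℚ.pos*pos⇒pos p {{ℚ.positive p>0}} q {{ℚ.positive q>0}}}}

p≤p+q : ∀ p {q} → 0ℚ ℚ.≤ q → p ℚ.≤ p ℚ.+ q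
p≤p+q p {q} 0≤q = subst (ℚ._≤ p ℚ.+ q) (ℚ.+-identityʳ p) (ℚ.+-monoʳ-≤ p 0≤q)

cauchy-≤ : ∀ x ε → 0ℚ ℚ.< ε → ∃[ K ] ∀ m n → K ℕ.≤ m → K ℕ.≤ n → seq x m ℚ.≤ seq x n ℚ.+ ε
cauchy-≤ x ε ε>0 with K , close ← cauchy x ε ε>0 = K , λ m n K≤m K≤n →
  ℚ.≤-trans (p≤q+∣p-q∣ (seq x m) (seq x n)) (ℚ.+-monoʳ-≤ (seq x n) (close m n K≤m K≤n))

≤-pointwise : ∀ {x y} → (∀ n → seq x n ℚ.≤ seq y n) → x ≤ y
≤-pointwise {x} {y} x≤y = mk≤ λ ε ε>0 → 0 , λ n _ → ℚ.≤-trans (x≤y n) (p≤p+q (seq y n) (ℚ.<⇒≤ ε>0))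

≤-refl : ∀ {x} → x ≤ x
≤-refl = ≤-pointwise λ _ → ℚ.≤-refl

≤-trans : ∀ {x y z} → x ≤ y → y ≤ z → x ≤ z
≤-trans {x} {y} {z} (mk≤ x≤y) (mk≤ y≤z) = mk≤ λ ε ε>0 →
  let ½ε>0 = *-pos (ℚ.positive⁻¹ ½) ε>0
      K , hx = x≤y (½ ℚ.* ε) ½ε>0
      L , hy = y≤z (½ ℚ.* ε) ½ε>0
  in K ℕ.+ L , λ n n≥ → begin
    seq x n                                  ≤⟨ hx n (ℕ.≤-trans (ℕ.m≤m+n K L) n≥) ⟩
    seq y n ℚ.+ ½ ℚ.* ε                      ≤⟨ ℚ.+-monoˡ-≤ (½ ℚ.* ε) (hy n (ℕ.≤-trans (ℕ.m≤n+m L K) n≥)) ⟩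
    seq z n ℚ.+ ½ ℚ.* ε ℚ.+ ½ ℚ.* ε          ≡⟨ solve 2 (λ z e → z :+ con ½ :* e :+ con ½ :* e := z :+ e)
                                                refl (seq z n) ε ⟩
    seq z n ℚ.+ ε                            ∎
  where
  open ℚ.≤-Reasoning
  open ℚ-Solver

fromℚ-mono-≤ : ∀ {p q} → p ℚ.≤ q → fromℚ p ≤ fromℚ q
fromℚ-mono-≤ p≤q = ≤-pointwise λ _ → p≤q

≤⇒≯ : ∀ {x y} → x ≤ y → ¬ (y < x)
≤⇒≯ {x} {y} (mk≤ x≤y) (mk< ε ε>0 (L , y+ε≤x)) =
  let K , hx = x≤y (½ ℚ.* ε) (*-pos (ℚ.positive⁻¹ ½) ε>0)
      n = K ℕ.+ L
  in ℚ.<-irrefl refl (begin-strict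
    seq x n                    ≤⟨ hx n (ℕ.m≤m+n K L) ⟩
    seq y n ℚ.+ ½ ℚ.* ε        <⟨ ℚ.+-monoʳ-< (seq y n) ½ε<ε ⟩
    seq y n ℚ.+ ε              ≤⟨ y+ε≤x n (ℕ.m≤n+m L K) ⟩
    seq x n                    ∎)
  where
  open ℚ.≤-Reasoning
  ½ε<ε : ½ ℚ.* ε ℚ.< ε
  ½ε<ε = subst (½ ℚ.* ε ℚ.<_) (ℚ.*-identityˡ ε)
    (ℚ.*-monoˡ-<-pos ε {{ℚ.positive ε>0}} {½} {1ℚ} (ℚ.*<* (ℤ.+<+ (ℕ.s≤s (ℕ.s≤s ℕ.z≤n)))))

-- Comparing one sufficiently late term of each sequence, with a margin, is decidable. A failed
-- comparison leaves a uniform rational gap, which is exactly a proof of `y < x`.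
≮⇒≥ : ∀ {x y} → ¬ (y < x) → x ≤ y
≮⇒≥ {x} {y} y≮x = mk≤ close
  where
  open ℚ.≤-Reasoning
  open ℚ-Solver
  -- The margin takes three parts `η`, and the oscillation of `x` and of `y` one part each, which
  -- makes `ε` in total. If the comparison fails, the margin minus both oscillations leaves a gap of
  -- `η`.
  ⅕ = + 1 ℚ./ 5

  close : ∀ ε → 0ℚ ℚ.< ε → ∃[ K ] ∀ n → K ℕ.≤ n → seq x n ℚ.≤ seq y n ℚ.+ ε
  close ε ε>0 = decide (seq x m ℚ.≤? seq y m ℚ.+ (η ℚ.+ η ℚ.+ η))
    where
    η = ⅕ ℚ.* ε
    η>0 = *-pos (ℚ.positive⁻¹ ⅕) ε>0
    K = proj₁ (cauchy-≤ x η η>0)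
    L = proj₁ (cauchy-≤ y η η>0)
    m = K ℕ.+ L
    K≤m = ℕ.m≤m+n K L
    L≤m = ℕ.m≤n+m L K

    decide : Dec (seq x m ℚ.≤ seq y m ℚ.+ (η ℚ.+ η ℚ.+ η)) →
             ∃[ K ] ∀ n → K ℕ.≤ n → seq x n ℚ.≤ seq y n ℚ.+ ε
    decide (yes x≤y) = m , λ n m≤n → begin
      seq x n
        ≤⟨ proj₂ (cauchy-≤ x η η>0) n m (ℕ.≤-trans K≤m m≤n) K≤m ⟩
      seq x m ℚ.+ η
        ≤⟨ ℚ.+-monoˡ-≤ η x≤y ⟩
      seq y m ℚ.+ (η ℚ.+ η ℚ.+ η) ℚ.+ η
        ≤⟨ ℚ.+-monoˡ-≤ η (ℚ.+-monoˡ-≤ (η ℚ.+ η ℚ.+ η)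
             (proj₂ (cauchy-≤ y η η>0) m n L≤m (ℕ.≤-trans L≤m m≤n))) ⟩
      seq y n ℚ.+ η ℚ.+ (η ℚ.+ η ℚ.+ η) ℚ.+ η
        ≡⟨ solve 2 (λ y e → let h = con ⅕ :* e in y :+ h :+ (h :+ h :+ h) :+ h := y :+ e) refl (seq y n) ε ⟩
      seq y n ℚ.+ ε ∎
    decide (no x≰y) = contradiction (mk< η η>0 (m , λ n m≤n → begin
      seq y n ℚ.+ η
        ≤⟨ ℚ.+-monoˡ-≤ η (proj₂ (cauchy-≤ y η η>0) n m (ℕ.≤-trans L≤m m≤n) L≤m) ⟩
      seq y m ℚ.+ η ℚ.+ η
        ≡⟨ solve 2 (λ y h → y :+ h :+ h := y :+ (h :+ h :+ h) :- h) refl (seq y m) η ⟩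
      seq y m ℚ.+ (η ℚ.+ η ℚ.+ η) ℚ.- η
        ≤⟨ ℚ.+-monoˡ-≤ (ℚ.- η) (ℚ.≤-trans (ℚ.<⇒≤ (ℚ.≰⇒> x≰y))
             (proj₂ (cauchy-≤ x η η>0) m n K≤m (ℕ.≤-trans K≤m m≤n))) ⟩
      seq x n ℚ.+ η ℚ.- η
        ≡⟨ solve 2 (λ x h → x :+ h :- h := x) refl (seq x n) η ⟩
      seq x n ∎)) y≮x

fromℤ-cancel-≤ : ∀ {a b} → fromℤ a ≤ fromℤ b → a ℤ.≤ b
fromℤ-cancel-≤ {a} {b} a≤b with (a ℚ./ 1) ℚ.≤? (b ℚ./ 1)
... | yes p≤q = /1-cancel-≤ p≤q
... | no  p≰q = contradiction gap (≤⇒≯ a≤b)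
  where
  open ℚ-Solver
  p q : ℚ
  p = a ℚ./ 1
  q = b ℚ./ 1
  gap : fromℤ b < fromℤ a
  gap = mk< (p ℚ.- q) (subst (ℚ._< p ℚ.- q) (ℚ.+-inverseʳ q) (ℚ.+-monoˡ-< (ℚ.- q) (ℚ.≰⇒> p≰q)))
    (0 , λ _ _ → ℚ.≤-reflexive (solve 2 (λ p q → q :+ (p :- q) := p) refl p q))

fromℚ≤⇒0< : ∀ {c y} → 0ℚ ℚ.< c → fromℚ c ≤ y → 0ℝ < y
fromℚ≤⇒0< {c} {y} c>0 (mk≤ c≤y) = mk< (½ ℚ.* c) ½c>0 (proj₁ (c≤y (½ ℚ.* c) ½c>0) , λ n n≥ → begin
  0ℚ ℚ.+ ½ ℚ.* c                    ≡⟨ solve 1 (λ c → con 0ℚ :+ con ½ :* c := c :- con ½ :* c) refl c ⟩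
  c ℚ.- ½ ℚ.* c                     ≤⟨ ℚ.+-monoˡ-≤ (ℚ.- (½ ℚ.* c)) (proj₂ (c≤y (½ ℚ.* c) ½c>0) n n≥) ⟩
  seq y n ℚ.+ ½ ℚ.* c ℚ.- ½ ℚ.* c   ≡⟨ solve 2 (λ y h → y :+ h :- h := y) refl (seq y n) (½ ℚ.* c) ⟩
  seq y n                           ∎)
  where
  open ℚ.≤-Reasoning
  open ℚ-Solver
  ½c>0 : 0ℚ ℚ.< ½ ℚ.* c
  ½c>0 = *-pos (ℚ.positive⁻¹ ½) c>0

-- Order properties of the real operations

opaque
  unfolding _+_

  +-mono-≤ : ∀ {x y u v} → x ≤ y → u ≤ v → x + u ≤ y + v
  +-mono-≤ {x} {y} {u} {v} (mk≤ x≤y) (mk≤ u≤v) = mk≤ λ ε ε>0 →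
    let ½ε>0 = *-pos (ℚ.positive⁻¹ ½) ε>0
        K , hx = x≤y (½ ℚ.* ε) ½ε>0
        L , hu = u≤v (½ ℚ.* ε) ½ε>0
    in K ℕ.+ L , λ n n≥ → ℚ.≤-trans
      (ℚ.+-mono-≤ (hx n (ℕ.≤-trans (ℕ.m≤m+n K L) n≥)) (hu n (ℕ.≤-trans (ℕ.m≤n+m L K) n≥)))
      (ℚ.≤-reflexive (solve 3 (λ y v e → (y :+ con ½ :* e) :+ (v :+ con ½ :* e) := (y :+ v) :+ e)
        refl (seq y n) (seq v n) ε))
    where open ℚ-Solver

  ⊔-mono-≤ : ∀ {x y u v} → x ≤ y → u ≤ v → x ⊔ u ≤ y ⊔ v
  ⊔-mono-≤ {x} {y} {u} {v} (mk≤ x≤y) (mk≤ u≤v) = mk≤ λ ε ε>0 →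
    let K , hx = x≤y ε ε>0
        L , hu = u≤v ε ε>0
    in K ℕ.+ L , λ n n≥ → ℚ.⊔-lub
      (ℚ.≤-trans (hx n (ℕ.≤-trans (ℕ.m≤m+n K L) n≥)) (ℚ.+-monoˡ-≤ ε (ℚ.p≤p⊔q (seq y n) (seq v n))))
      (ℚ.≤-trans (hu n (ℕ.≤-trans (ℕ.m≤n+m L K) n≥)) (ℚ.+-monoˡ-≤ ε (ℚ.p≤q⊔p (seq y n) (seq v n))))

  x≤x⊔y : ∀ x y → x ≤ x ⊔ y
  x≤x⊔y x y = ≤-pointwise λ n → ℚ.p≤p⊔q (seq x n) (seq y n)

  y≤x⊔y : ∀ x y → y ≤ x ⊔ y
  y≤x⊔y x y = ≤-pointwise λ n → ℚ.p≤q⊔p (seq x n) (seq y n)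

  ⊔-lub-< : ∀ {x y z} → x < z → y < z → x ⊔ y < z
  ⊔-lub-< {x} {y} {z} (mk< ε ε>0 (K , hx)) (mk< ε′ ε′>0 (L , hy)) =
    mk< (ε ℚ.⊓ ε′) (min-pos (ℚ.⊓-sel ε ε′)) (K ℕ.+ L , λ n n≥ →
      subst (ℚ._≤ seq z n) (sym (ℚ.mono-≤-distrib-⊔ (ℚ.+-monoˡ-≤ (ε ℚ.⊓ ε′)) (seq x n) (seq y n)))
        (ℚ.⊔-lub
          (ℚ.≤-trans (ℚ.+-monoʳ-≤ (seq x n) (ℚ.p⊓q≤p ε ε′)) (hx n (ℕ.≤-trans (ℕ.m≤m+n K L) n≥)))
          (ℚ.≤-trans (ℚ.+-monoʳ-≤ (seq y n) (ℚ.p⊓q≤q ε ε′)) (hy n (ℕ.≤-trans (ℕ.m≤n+m L K) n≥)))))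
    where
    min-pos : ε ℚ.⊓ ε′ ≡ ε ⊎ ε ℚ.⊓ ε′ ≡ ε′ → 0ℚ ℚ.< ε ℚ.⊓ ε′
    min-pos (inj₁ eq) = subst (0ℚ ℚ.<_) (sym eq) ε>0
    min-pos (inj₂ eq) = subst (0ℚ ℚ.<_) (sym eq) ε′>0

  fromℚ-*-mono-≤ : ∀ {k x y} → 0ℚ ℚ.≤ k → x ≤ y → fromℚ k * x ≤ fromℚ k * y
  fromℚ-*-mono-≤ {k} {x} {y} k≥0 (mk≤ x≤y) = mk≤ λ ε ε>0 →
    let
      k+1>0 : 0ℚ ℚ.< k ℚ.+ 1ℚ
      k+1>0 = ℚ.+-mono-≤-< k≥0 (ℚ.positive⁻¹ 1ℚ)
      instance
        k-nonNeg = ℚ.nonNegative k≥0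
        k+1-pos = ℚ.positive k+1>0
        k+1-nonZero = ℚ.pos⇒nonZero (k ℚ.+ 1ℚ)
      -- The reciprocal of `k + 1` is taken because `k` may be 0; the extra summand `η` added below
      -- then completes the error to `ε`.
      i = ℚ.1/ (k ℚ.+ 1ℚ)
      η = i ℚ.* ε
      η>0 = *-pos (ℚ.positive⁻¹ i {{ℚ.1/pos⇒pos (k ℚ.+ 1ℚ)}}) ε>0
      K , hx = x≤y η η>0
    in K , λ n n≥ → begin
      k ℚ.* seq x n                       ≤⟨ ℚ.*-monoˡ-≤-nonNeg k (hx n n≥) ⟩
      k ℚ.* (seq y n ℚ.+ η)               ≤⟨ p≤p+q _ (ℚ.<⇒≤ η>0) ⟩
      k ℚ.* (seq y n ℚ.+ η) ℚ.+ η         ≡⟨ solve 4 (λ k y i e → k :* (y :+ i :* e) :+ i :* e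
                                             := k :* y :+ (k :+ con 1ℚ) :* i :* e) refl k (seq y n) i ε ⟩
      k ℚ.* seq y n ℚ.+ (k ℚ.+ 1ℚ) ℚ.* i ℚ.* ε  ≡⟨ cong (λ z → k ℚ.* seq y n ℚ.+ z ℚ.* ε) (ℚ.*-inverseʳ (k ℚ.+ 1ℚ)) ⟩
      k ℚ.* seq y n ℚ.+ 1ℚ ℚ.* ε          ≡⟨ cong (k ℚ.* seq y n ℚ.+_) (ℚ.*-identityˡ ε) ⟩
      k ℚ.* seq y n ℚ.+ ε                 ∎
    where
    open ℚ.≤-Reasoning
    open ℚ-Solver

  fromℚ-+ : ∀ p q → fromℚ (p ℚ.+ q) ≃ fromℚ p + fromℚ q
  fromℚ-+ p q = ≤-pointwise (λ _ → ℚ.≤-refl) , ≤-pointwise (λ _ → ℚ.≤-refl)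

  fromℚ-* : ∀ p q → fromℚ (p ℚ.* q) ≃ fromℚ p * fromℚ q
  fromℚ-* p q = ≤-pointwise (λ _ → ℚ.≤-refl) , ≤-pointwise (λ _ → ℚ.≤-refl)

  +-swap-≤ : ∀ x y z → x + y + z ≤ x + z + y
  +-swap-≤ x y z = ≤-pointwise λ n → ℚ.≤-reflexive
    (solve 3 (λ x y z → x :+ y :+ z := x :+ z :+ y) refl (seq x n) (seq y n) (seq z n))
    where open ℚ-Solver

  y+[ρ-1]y≤ρy : ∀ ρ y → y + fromℚ (ρ ℚ.- 1ℚ) * y ≤ fromℚ ρ * y
  y+[ρ-1]y≤ρy ρ y = ≤-pointwise λ n → ℚ.≤-reflexive
    (solve 2 (λ r y → y :+ (r :- con 1ℚ) :* y := r :* y) refl ρ (seq y n))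
    where open ℚ-Solver

  -- The reciprocal belongs to `y` clamped below by `δ`, which agrees with `y` from index `L` on. A
  -- tolerance of `δ * ε` before the division is at most `ε` after it, as `i * δ ≤ i * clamp n = 1`.
  x≤ρy⇒x÷y≤ρ : ∀ {x y ρ} (y>0 : 0ℝ < y) → x ≤ fromℚ ρ * y → x ÷ y [ y>0 ] ≤ fromℚ ρ
  x≤ρy⇒x÷y≤ρ {x} {y} {ρ} (mk< δ δ>0 (L , δ≤y)) (mk≤ x≤ρy) = mk≤ λ ε ε>0 →
    let K , hx = x≤ρy (δ ℚ.* ε) (*-pos δ>0 ε>0)
    in K ℕ.+ L , λ n n≥ →
      let
        i = inv n
        clamp≡y : clamp n ≡ seq y n
        clamp≡y = ℚ.p≤q⇒p⊔q≡q (subst (ℚ._≤ seq y n) (ℚ.+-identityˡ δ)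
          (δ≤y n (ℕ.≤-trans (ℕ.m≤n+m L K) n≥)))
        i*y≡1 : i ℚ.* seq y n ≡ 1ℚ
        i*y≡1 = trans (cong (i ℚ.*_) (sym clamp≡y)) (inv*clamp n)
        instance
          i-nonNeg = ℚ.nonNegative (inv≥0 n)
          δ-nonNeg = ℚ.nonNegative (ℚ.<⇒≤ δ>0)
          ε-nonNeg = ℚ.nonNegative (ℚ.<⇒≤ ε>0)
      in begin
        seq x n ℚ.* i
          ≤⟨ ℚ.*-monoʳ-≤-nonNeg i (hx n (ℕ.≤-trans (ℕ.m≤m+n K L) n≥)) ⟩
        (ρ ℚ.* seq y n ℚ.+ δ ℚ.* ε) ℚ.* i
          ≡⟨ solve 5 (λ r y d e i → (r :* y :+ d :* e) :* i := r :* (i :* y) :+ i :* d :* e)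
               refl ρ (seq y n) δ ε i ⟩
        ρ ℚ.* (i ℚ.* seq y n) ℚ.+ i ℚ.* δ ℚ.* ε
          ≤⟨ ℚ.+-monoʳ-≤ (ρ ℚ.* (i ℚ.* seq y n)) (ℚ.*-monoʳ-≤-nonNeg ε
               (ℚ.*-monoˡ-≤-nonNeg i (δ≤clamp n))) ⟩
        ρ ℚ.* (i ℚ.* seq y n) ℚ.+ i ℚ.* clamp n ℚ.* ε
          ≡⟨ cong₂ (λ s t → ρ ℚ.* s ℚ.+ t ℚ.* ε) i*y≡1 (inv*clamp n) ⟩
        ρ ℚ.* 1ℚ ℚ.+ 1ℚ ℚ.* ε
          ≡⟨ cong₂ ℚ._+_ (ℚ.*-identityʳ ρ) (ℚ.*-identityˡ ε) ⟩
        ρ ℚ.+ ε ∎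
    where
    open ℚ.≤-Reasoning
    open ℚ-Solver
    open Reciprocal y δ δ>0

  -- All sequences involved are constant, so both inequalities follow from one identity of
  -- rationals.
  tardinessCost-fromℤ : ∀ w t p d → fromℕ w * ((fromℤ t + fromℕ p - fromℕ d) ⁺)
                        ≃ fromℤ (+ w ℤ.* ((t ℤ.+ + p ℤ.- + d) ℤ.⊔ + 0))
  tardinessCost-fromℤ w t p d =
    ≤-pointwise (λ _ → ℚ.≤-reflexive (sym homomorphic)) , ≤-pointwise (λ _ → ℚ.≤-reflexive homomorphic)
    where
    open ≡-Reasoning
    homomorphic : (+ w ℤ.* ((t ℤ.+ + p ℤ.- + d) ℤ.⊔ + 0)) ℚ./ 1 ≡
                  ℕ→ℚ w ℚ.* ((t ℚ./ 1 ℚ.+ ℕ→ℚ p ℚ.- ℕ→ℚ d) ℚ.⊔ 0ℚ)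
    homomorphic = begin
      (+ w ℤ.* ((t ℤ.+ + p ℤ.- + d) ℤ.⊔ + 0)) ℚ./ 1
        ≡⟨ /1-* (+ w) _ ⟩
      ℕ→ℚ w ℚ.* (((t ℤ.+ + p ℤ.- + d) ℤ.⊔ + 0) ℚ./ 1)
        ≡⟨ cong (ℕ→ℚ w ℚ.*_) (/1-⊔ (t ℤ.+ + p ℤ.- + d) (+ 0)) ⟩
      ℕ→ℚ w ℚ.* ((t ℤ.+ + p ℤ.- + d) ℚ./ 1 ℚ.⊔ 0ℚ)
        ≡⟨ cong (λ z → ℕ→ℚ w ℚ.* (z ℚ.⊔ 0ℚ)) (/1-+ (t ℤ.+ + p) (ℤ.- + d)) ⟩
      ℕ→ℚ w ℚ.* ((t ℤ.+ + p) ℚ./ 1 ℚ.+ (ℤ.- + d) ℚ./ 1 ℚ.⊔ 0ℚ)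
        ≡⟨ cong₂ (λ y z → ℕ→ℚ w ℚ.* (y ℚ.+ z ℚ.⊔ 0ℚ)) (/1-+ t (+ p)) (/1-neg (+ d)) ⟩
      ℕ→ℚ w ℚ.* ((t ℚ./ 1 ℚ.+ ℕ→ℚ p ℚ.- ℕ→ℚ d) ℚ.⊔ 0ℚ) ∎

∑ℝ-mono-≤ : ∀ {n} {f g : Vector ℝ n} → (∀ j → f j ≤ g j) → ∑ℝ f ≤ ∑ℝ g
∑ℝ-mono-≤ {zero}  f≤g = ≤-refl
∑ℝ-mono-≤ {suc n} f≤g = +-mono-≤ (f≤g zero) (∑ℝ-mono-≤ (f≤g ∘ suc))

fromℤ-+ : ∀ a b → fromℤ (a ℤ.+ b) ≃ fromℤ a + fromℤ b
fromℤ-+ a b = subst (λ q → fromℚ q ≃ fromℤ a + fromℤ b) (sym (/1-+ a b)) (fromℚ-+ (a ℚ./ 1) (b ℚ./ 1))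

fromℕ-+ : ∀ m n → fromℕ (m ℕ.+ n) ≤ fromℕ m + fromℕ n
fromℕ-+ m n = proj₁ (fromℤ-+ (+ m) (+ n))

∑ℝ-fromℤ : ∀ {n} (f : Vector ℤ n) → ∑ℝ (fromℤ ∘ f) ≃ fromℤ (∑ℤ f)
∑ℝ-fromℤ {zero}  f = ≤-refl , ≤-refl
∑ℝ-fromℤ {suc n} f with ≥ , ≤ ← fromℤ-+ (f zero) (∑ℤ (f ∘ suc)) | ≤′ , ≥′ ← ∑ℝ-fromℤ (f ∘ suc) =
  ≤-trans (+-mono-≤ ≤-refl ≤′) ≤ , ≤-trans ≥ (+-mono-≤ ≤-refl ≥′)

-- Rounding to the phase grids

⅛ : ℚ
⅛ = + 1 ℚ./ 8

⅛>0 : 0ℚ ℚ.< ⅛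
⅛>0 = ℚ.positive⁻¹ ⅛

opaque
  unfolding _+_

  -- A term that lies within `⅛` of all later ones. Equal reals may receive different values; this
  -- does no harm, since the values only serve to order the jobs of one given schedule.
  approximation : ℝ → ℚ
  approximation x = seq x (proj₁ (cauchy-≤ x ⅛ ⅛>0))

  -- Two errors of `⅛` and the strictness gap `½` add up to less than 1, and `p` is at least 1.
  approximation-≤⇒<+ : ∀ {x y} p {{_ : NonZero p}} → approximation x ℚ.≤ approximation y → x < y + fromℕ p
  approximation-≤⇒<+ {x} {y} p x≤y = mk< ½ (ℚ.positive⁻¹ ½) (K ℕ.+ L , λ n n≥ → begin
    seq x n ℚ.+ ½
      ≤⟨ ℚ.+-monoˡ-≤ ½ (proj₂ (cauchy-≤ x ⅛ ⅛>0) n K (ℕ.≤-trans (ℕ.m≤m+n K L) n≥) ℕ.≤-refl) ⟩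
    approximation x ℚ.+ ⅛ ℚ.+ ½
      ≤⟨ ℚ.+-monoˡ-≤ ½ (ℚ.+-monoˡ-≤ ⅛ x≤y) ⟩
    approximation y ℚ.+ ⅛ ℚ.+ ½
      ≤⟨ ℚ.+-monoˡ-≤ ½ (ℚ.+-monoˡ-≤ ⅛
           (proj₂ (cauchy-≤ y ⅛ ⅛>0) L n ℕ.≤-refl (ℕ.≤-trans (ℕ.m≤n+m L K) n≥))) ⟩
    seq y n ℚ.+ ⅛ ℚ.+ ⅛ ℚ.+ ½
      ≤⟨ p≤p+q _ (ℚ.nonNegative⁻¹ (⅛ ℚ.+ ⅛)) ⟩
    seq y n ℚ.+ ⅛ ℚ.+ ⅛ ℚ.+ ½ ℚ.+ (⅛ ℚ.+ ⅛)
      ≡⟨ solve 1 (λ y → y :+ con ⅛ :+ con ⅛ :+ con ½ :+ (con ⅛ :+ con ⅛) := y :+ con 1ℚ) refl (seq y n) ⟩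
    seq y n ℚ.+ 1ℚ
      ≤⟨ ℚ.+-monoʳ-≤ (seq y n) (ℕ→ℚ-mono-≤ (ℕ.>-nonZero⁻¹ p)) ⟩
    seq y n ℚ.+ ℕ→ℚ p ∎)
    where
    open ℚ.≤-Reasoning
    open ℚ-Solver
    K L : ℕ
    K = proj₁ (cauchy-≤ x ⅛ ⅛>0)
    L = proj₁ (cauchy-≤ y ⅛ ⅛>0)

-- Ranks of rational keys

indicator : ∀ {A : Set} → Dec A → ℕ
indicator (yes _) = 1
indicator (no  _) = 0

indicator-mono : ∀ {A B : Set} (a : Dec A) (b : Dec B) → (A → B) → indicator a ℕ.≤ indicator b
indicator-mono (no _)  _       _   = ℕ.z≤n
indicator-mono (yes a) (yes _) _   = ℕ.≤-refl
indicator-mono (yes a) (no ¬b) a⇒b = contradiction (a⇒b a) ¬b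

indicator-strict : ∀ {A B : Set} (a : Dec A) (b : Dec B) → ¬ A → B → indicator a ℕ.+ 1 ℕ.≤ indicator b
indicator-strict (yes a) _       ¬a _ = contradiction a ¬a
indicator-strict (no _)  (yes _) _  _ = ℕ.≤-refl
indicator-strict (no _)  (no ¬b) _  b = contradiction b ¬b

module Ranking {n} (q : Fin n → ℚ) where

  opaque
    -- Counting smaller keys replaces the order of ℚ, which is not well-founded, by that of ℕ, and
    -- it also bounds the length of chains of predecessors.
    rank : Fin n → ℕ
    rank j = ∑ℕ λ l → indicator (q l ℚ.<? q j)

    -- Every index counted for `i` is counted for `j`, and `i` itself is counted for `j` only.
    rank-mono-< : ∀ {i j} → q i ℚ.< q j → rank i ℕ.< rank j
    rank-mono-< {i} {j} i<j = subst (ℕ._≤ rank j) (ℕ.+-comm (rank i) 1) (∑ℕ-mono-gap i 1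
      (λ l → indicator-mono (q l ℚ.<? q i) (q l ℚ.<? q j) (λ l<i → ℚ.<-trans l<i i<j))
      (indicator-strict (q i ℚ.<? q i) (q i ℚ.<? q j) (ℚ.<-irrefl refl) i<j))

    -- An index is not counted in its own rank, which leaves a slack of 1 against counting all `n`
    -- indices.
    rank<n : ∀ j → rank j ℕ.< n
    rank<n j = begin
      suc (rank j)              ≡⟨ ℕ.+-comm 1 (rank j) ⟩
      rank j ℕ.+ 1              ≤⟨ ∑ℕ-mono-gap {g = λ _ → 1} j 1
                                     (λ l → indicator-≤1 (q l ℚ.<? q j))
                                     (indicator-strict {B = q j ≡ q j} (q j ℚ.<? q j) (yes refl) (ℚ.<-irrefl refl) refl) ⟩
      ∑ℕ {n} (λ _ → 1)          ≡⟨ count n ⟩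
      n                         ∎
      where
      open ℕ.≤-Reasoning
      indicator-≤1 : ∀ {A : Set} (a : Dec A) → indicator a ℕ.≤ 1
      indicator-≤1 (yes _) = ℕ.≤-refl
      indicator-≤1 (no  _) = ℕ.z≤n
      count : ∀ n → ∑ℕ {n} (λ _ → 1) ≡ n
      count zero    = refl
      count (suc n) = cong suc (count n)

  rank-cancel-< : ∀ {i j} → rank i ℕ.< rank j → q i ℚ.≤ q j
  rank-cancel-< {i} {j} i<j with q i ℚ.≤? q j
  ... | yes i≤j = i≤j
  ... | no  i≰j = contradiction (rank-mono-< (ℚ.≰⇒> i≰j)) (ℕ.<-asym i<j)

-- Integer schedules and their cost

module _ (I : Instance) where
  open Problem I

  -- The field `chain` makes the residues of the starts phases of the algorithm, and its bound
  -- `k < N` makes the rounded starts time nodes.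
  record IntegerSchedule : Set where
    field
      v         : Fin N → ℕ
      separated : ∀ i j → i ≢ j → v i ℕ.+ p ℕ.≤ v j ⊎ v j ℕ.+ p ℕ.≤ v i
      r≤v       : ∀ j → r j ℕ.≤ v j
      chain     : ∀ j → ∃[ l ] ∃[ k ] k ℕ.< N × v j ≡ r l ℕ.+ k ℕ.* p

    G : ℤ
    G = ∑ℤ λ j → edgeCost j (+ v j)

  -- Stated for arbitrary integer times, as it serves the matchings as well as the left-shifted
  -- starts, which are not packaged as a `Schedule`.
  F-fromℤ : (t : Fin N → ℤ) →
            ∑ℝ (λ j → fromℕ (w j) * ((fromℤ (t j) + fromℕ p - fromℕ (d j)) ⁺))
            ≃ fromℤ (∑ℤ λ j → edgeCost j (t j))
  F-fromℤ t =
    ≤-trans (∑ℝ-mono-≤ λ j → proj₁ (tardinessCost-fromℤ (w j) (t j) p (d j)))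
            (proj₁ (∑ℝ-fromℤ λ j → edgeCost j (t j))) ,
    ≤-trans (proj₂ (∑ℝ-fromℤ λ j → edgeCost j (t j)))
            (∑ℝ-mono-≤ λ j → proj₂ (tardinessCost-fromℤ (w j) (t j) p (d j)))

  F-schedule : ∀ {a} (M : Matching a) → F (schedule M) ≃ fromℤ (cost M)
  F-schedule M = F-fromℤ (time M)

-- Left shift of a real schedule

module Shifting (I : Instance) (S : Problem.Schedule I) where
  open Problem I
  s : Fin N → ℝ
  s = start S

  q : Fin N → ℚ
  q = approximation ∘ s

  open Ranking q
  open LeftShift p r rank

  -- If `s j` were less than `s i + p`, the point `s i ⊔ s j` would lie in both processing
  -- intervals. Taking the maximum avoids deciding which start is later.
  ordered : ∀ {i j} → i ≢ j → q i ℚ.≤ q j → s i + fromℕ p ≤ s j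
  ordered {i} {j} i≢j qi≤qj = ≮⇒≥ λ sj<si+p → disjoint S i j i≢j (s i ⊔ s j)
    ( (x≤x⊔y (s i) (s j) , ⊔-lub-< (approximation-≤⇒<+ p ℚ.≤-refl) sj<si+p)
    , (y≤x⊔y (s i) (s j) , ⊔-lub-< (approximation-≤⇒<+ p qi≤qj) (approximation-≤⇒<+ p ℚ.≤-refl)))

  -- Equal keys are impossible: `ordered` would give `s i + p ≤ s j`, whereas the approximations
  -- give `s j < s i + p`.
  rank-≢ : ∀ i j → i ≢ j → i ≺ j ⊎ j ≺ i
  rank-≢ i j i≢j with ℚ.<-cmp (q i) (q j)
  ... | tri< i<j _ _ = inj₁ (rank-mono-< i<j)
  ... | tri> _ _ j<i = inj₂ (rank-mono-< j<i)
  ... | tri≈ _ eq _  = contradiction (approximation-≤⇒<+ p (ℚ.≤-reflexive (sym eq)))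
    (≤⇒≯ (ordered i≢j (ℚ.≤-reflexive eq)))

  -- By tightness `v j` is a release date or the completion of a predecessor. The former bounds
  -- `s j` by feasibility, the latter by induction, because `S` processes the jobs in the order of
  -- rank.
  v≤s : ∀ j → fromℕ (v j) ≤ s j
  v≤s = WF.All.wfRec ≺-wellFounded _ (λ j → fromℕ (v j) ≤ s j) λ j IH → bound j IH (v-tight j)
    where
    completed : ∀ {i j} → i ≺ j → fromℕ (v i) ≤ s i → fromℕ (v i ℕ.+ p) ≤ s j
    completed {i} {j} i≺j v≤s = ≤-trans (fromℕ-+ (v i) p) (≤-trans (+-mono-≤ v≤s ≤-refl)
      (ordered (λ { refl → ℕ.<-irrefl refl i≺j }) (rank-cancel-< i≺j)))

    bound : ∀ j → (∀ {i} → i ≺ j → fromℕ (v i) ≤ s i) →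
            v j ≡ r j ⊎ (∃[ i ] i ≺ j × v j ≡ v i ℕ.+ p) → fromℕ (v j) ≤ s j
    bound j IH (inj₁ eq)             = subst (λ t → fromℕ t ≤ s j) (sym eq) (released S j)
    bound j IH (inj₂ (i , i≺j , eq)) = subst (λ t → fromℕ t ≤ s j) (sym eq) (completed i≺j (IH i≺j))

  leftShifted : IntegerSchedule I
  leftShifted = record
    { v         = v
    ; separated = λ i j i≢j → sep (rank-≢ i j i≢j)
    ; r≤v       = r≤v
    ; chain     = λ j → let l , k , k≤ , eq = v-chain j in l , k , ℕ.≤-<-trans k≤ (rank<n j) , eq
    }
    where
    sep : ∀ {i j} → i ≺ j ⊎ j ≺ i → v i ℕ.+ p ℕ.≤ v j ⊎ v j ℕ.+ p ℕ.≤ v i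
    sep (inj₁ i≺j) = inj₁ (v+p≤v i≺j)
    sep (inj₂ j≺i) = inj₂ (v+p≤v j≺i)

  -- Weighted tardiness is monotone in the start times, and no start is later after the shift.
  G≤F : fromℤ (IntegerSchedule.G leftShifted) ≤ F S
  G≤F = ≤-trans (proj₂ (F-fromℤ I (λ j → + v j))) (∑ℝ-mono-≤ λ j →
    fromℚ-*-mono-≤ (ℕ→ℚ-mono-≤ {0} {w j} ℕ.z≤n)
      (⊔-mono-≤ (+-mono-≤ (+-mono-≤ (v≤s j) ≤-refl) ≤-refl) ≤-refl))

-- Rounded starts as matchings

module Rounding (I : Instance) (V : IntegerSchedule I) where
  open Problem I
  open IntegerSchedule V

  phaseOf : Fin N → ℕ
  phaseOf i = v i ℕ.% p

  -- Along its chain, `v i` differs from some release date by a multiple of `p`.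
  phaseOf∈𝒜 : ∀ i → phaseOf i ∈ 𝒜
  phaseOf∈𝒜 i with l , k , _ , eq ← chain i =
    subst (_∈ 𝒜) (sym (trans (cong (ℕ._% p) eq) (ℕ.[m+kn]%n≡m%n (r l) k p)))
      (∈-map⁺ (λ j → r j ℕ.% p) (∈-allFin l))

  -- The least nonnegative shift that takes `v j` to the grid through `v i`.
  delay : Fin N → Fin N → ℕ
  delay i j = (+ v i ℤ.- + v j) ℤ.%ℕ p

  delay<p : ∀ i j → delay i j ℕ.< p
  delay<p i j = ℤ.n%ℕd<d (+ v i ℤ.- + v j) p

  delay-pair : ∀ i j → delay i j ℕ.+ delay j i ℕ.≤ p
  delay-pair i j = subst (λ x → delay i j ℕ.+ x ℤ.%ℕ p ℕ.≤ p)
    (solve 2 (λ a b → :- (a :- b) := b :- a) refl (+ v i) (+ v j))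
    (%ℕ+neg%ℕ≤ (+ v i ℤ.- + v j) p)
    where open ℤ-Solver

  delay-diagonal : ∀ i → delay i i ≡ 0
  delay-diagonal i = trans (cong (ℤ._%ℕ p) (ℤ.+-inverseʳ (+ v i))) (0%ℕ≡0 p)

  slot : Fin N → Fin N → ℕ
  slot i j = v j ℕ.+ delay i j

  -- Subtract v i − v j = delay i j + q · p from v i = phaseOf i + (v i / p) · p.
  slot-on-grid : ∀ i j → ∃[ c ] + slot i j ≡ + phaseOf i ℤ.+ c ℤ.* + p
  slot-on-grid i j = + (v i ℕ./ p) ℤ.- x ℤ./ℕ p , (begin
    + v j ℤ.+ + delay i j
      ≡⟨ solve 4 (λ b e q p → b :+ e := b :+ (e :+ q :* p) :- q :* p) refl
           (+ v j) (+ delay i j) (x ℤ./ℕ p) (+ p) ⟩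
    + v j ℤ.+ (+ delay i j ℤ.+ x ℤ./ℕ p ℤ.* + p) ℤ.- x ℤ./ℕ p ℤ.* + p
      ≡⟨ cong (λ z → + v j ℤ.+ z ℤ.- x ℤ./ℕ p ℤ.* + p) (ℤ.a≡a%ℕn+[a/ℕn]*n x p) ⟨
    + v j ℤ.+ x ℤ.- x ℤ./ℕ p ℤ.* + p
      ≡⟨ solve 4 (λ a b q p → b :+ (a :- b) :- q :* p := a :- q :* p) refl
           (+ v i) (+ v j) (x ℤ./ℕ p) (+ p) ⟩
    + v i ℤ.- x ℤ./ℕ p ℤ.* + p
      ≡⟨ cong (ℤ._- x ℤ./ℕ p ℤ.* + p) (ℤ.a≡a%ℕn+[a/ℕn]*n (+ v i) p) ⟩
    + phaseOf i ℤ.+ + (v i ℕ./ p) ℤ.* + p ℤ.- x ℤ./ℕ p ℤ.* + p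
      ≡⟨ solve 4 (λ a b q p → a :+ b :* p :- q :* p := a :+ (b :- q) :* p) refl
           (+ phaseOf i) (+ (v i ℕ./ p)) (x ℤ./ℕ p) (+ p) ⟩
    + phaseOf i ℤ.+ (+ (v i ℕ./ p) ℤ.- x ℤ./ℕ p) ℤ.* + p ∎)
    where
    open ≡-Reasoning
    open ℤ-Solver
    x = + v i ℤ.- + v j

  -- The interval from `r l` to `r l + p`, open on the right, contains only one point of the grid,
  -- so a grid point in it must be the rounded release date.
  R-grid : ∀ a l c e → e ℕ.< p → + r l ℤ.+ + e ≡ + a ℤ.+ c ℤ.* + p → R a l ≡ + r l ℤ.+ + e
  R-grid a l c e e<p eq = begin
    + a ℤ.+ + p ℤ.* ℚ.ceiling (z ℚ./ p)   ≡⟨ cong (λ x → + a ℤ.+ + p ℤ.* x) (ceiling-unique z p c lower upper) ⟩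
    + a ℤ.+ + p ℤ.* c                     ≡⟨ cong (λ x → + a ℤ.+ x) (ℤ.*-comm (+ p) c) ⟩
    + a ℤ.+ c ℤ.* + p                     ≡⟨ eq ⟨
    + r l ℤ.+ + e                         ∎
    where
    open ≡-Reasoning
    open ℤ-Solver
    z = + r l ℤ.- + a

    c*p≡z+e : c ℤ.* + p ≡ z ℤ.+ + e
    c*p≡z+e = begin
      c ℤ.* + p                           ≡⟨ solve 2 (λ a x → x := a :+ x :- a) refl (+ a) (c ℤ.* + p) ⟩
      + a ℤ.+ c ℤ.* + p ℤ.- + a           ≡⟨ cong (ℤ._- + a) eq ⟨
      + r l ℤ.+ + e ℤ.- + a               ≡⟨ solve 3 (λ r e a → r :+ e :- a := r :- a :+ e) refl
                                              (+ r l) (+ e) (+ a) ⟩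
      z ℤ.+ + e                           ∎

    lower : z ℤ.≤ c ℤ.* + p
    lower = subst (z ℤ.≤_) (sym c*p≡z+e) (ℤ.i≤i+j z (+ e))

    upper : c ℤ.* + p ℤ.< z ℤ.+ + p
    upper = subst (ℤ._< z ℤ.+ + p) (sym c*p≡z+e) (ℤ.+-monoʳ-< z (ℤ.+<+ e<p))

  -- By the chain `v j` is `r l + k p`, so going back `k` periods from the slot gives the grid point
  -- `r l + delay i j`, the rounding of `r l`. The index `k` of the chain is thus the index of the
  -- node.
  slot-node : ∀ i j → 𝒯 (phaseOf i) (+ slot i j)
  slot-node i j = onNode (chain j) (slot-on-grid i j)
    where
    open ≡-Reasoning
    open ℤ-Solver

    onNode : (∃[ l ] ∃[ k ] k ℕ.< N × v j ≡ r l ℕ.+ k ℕ.* p) →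
            (∃[ c ] + slot i j ≡ + phaseOf i ℤ.+ c ℤ.* + p) → 𝒯 (phaseOf i) (+ slot i j)
    onNode (l , k , k<N , eq) (c , on-grid) = l , k , k<N , (begin
      + slot i j                                ≡⟨ slot≡ ⟩
      + r l ℤ.+ + delay i j ℤ.+ + k ℤ.* + p     ≡⟨ cong (ℤ._+ + k ℤ.* + p)
                                                     (R-grid (phaseOf i) l (c ℤ.- + k) (delay i j) (delay<p i j) rounded) ⟨
      R (phaseOf i) l ℤ.+ + k ℤ.* + p           ∎)
      where
      slot≡ : + slot i j ≡ + r l ℤ.+ + delay i j ℤ.+ + k ℤ.* + p
      slot≡ = begin
        + v j ℤ.+ + delay i j                          ≡⟨ cong (λ x → + x ℤ.+ + delay i j) eq ⟩
        + r l ℤ.+ + (k ℕ.* p) ℤ.+ + delay i j          ≡⟨ cong (λ x → + r l ℤ.+ x ℤ.+ + delay i j) (ℤ.pos-* k p) ⟩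
        + r l ℤ.+ + k ℤ.* + p ℤ.+ + delay i j          ≡⟨ solve 3 (λ a b c → a :+ b :+ c := a :+ c :+ b) refl
                                                            (+ r l) (+ k ℤ.* + p) (+ delay i j) ⟩
        + r l ℤ.+ + delay i j ℤ.+ + k ℤ.* + p          ∎

      rounded : + r l ℤ.+ + delay i j ≡ + phaseOf i ℤ.+ (c ℤ.- + k) ℤ.* + p
      rounded = begin
        + r l ℤ.+ + delay i j
          ≡⟨ solve 2 (λ x y → x := x :+ y :- y) refl (+ r l ℤ.+ + delay i j) (+ k ℤ.* + p) ⟩
        + r l ℤ.+ + delay i j ℤ.+ + k ℤ.* + p ℤ.- + k ℤ.* + p
          ≡⟨ cong (ℤ._- + k ℤ.* + p) (trans (sym slot≡) on-grid) ⟩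
        + phaseOf i ℤ.+ c ℤ.* + p ℤ.- + k ℤ.* + p
          ≡⟨ solve 4 (λ a c k p → a :+ c :* p :- k :* p := a :+ (c :- k) :* p) refl
               (+ phaseOf i) c (+ k) (+ p) ⟩
        + phaseOf i ℤ.+ (c ℤ.- + k) ℤ.* + p ∎

  -- All delays are less than `p`, so starts that are at least `p` apart keep their strict order.
  slot-injective : ∀ i {j j′} → slot i j ≡ slot i j′ → j ≡ j′
  slot-injective i {j} {j′} eq with j Fin.≟ j′
  ... | yes j≡j′ = j≡j′
  ... | no  j≢j′ = contradiction eq (distinct (separated j j′ j≢j′))
    where
    open ℕ.≤-Reasoning
    apart : ∀ {j j′} → v j ℕ.+ p ℕ.≤ v j′ → slot i j ℕ.< slot i j′
    apart {j} {j′} vj+p≤vj′ = begin-strict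
      v j ℕ.+ delay i j       <⟨ ℕ.+-monoʳ-< (v j) (delay<p i j) ⟩
      v j ℕ.+ p               ≤⟨ vj+p≤vj′ ⟩
      v j′                    ≤⟨ ℕ.m≤m+n (v j′) (delay i j′) ⟩
      v j′ ℕ.+ delay i j′     ∎
    distinct : v j ℕ.+ p ℕ.≤ v j′ ⊎ v j′ ℕ.+ p ℕ.≤ v j → slot i j ≢ slot i j′
    distinct (inj₁ before) eq = ℕ.<-irrefl eq (apart before)
    distinct (inj₂ after)  eq = ℕ.<-irrefl (sym eq) (apart after)

  rounding : ∀ i → Matching (phaseOf i)
  rounding i = record
    { time      = λ j → + slot i j
    ; node      = slot-node i
    ; edge      = λ j → ℤ.+≤+ (ℕ.≤-trans (r≤v j) (ℕ.m≤m+n (v j) (delay i j)))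
    ; injective = λ eq → slot-injective i (ℤ.+-injective eq)
    }

  -- The positive part grows by at most `e` when its argument grows by `e`.
  edgeCost-delay : ∀ j e → edgeCost j (+ (v j ℕ.+ e)) ℤ.≤ edgeCost j (+ v j) ℤ.+ + (w j ℕ.* e)
  edgeCost-delay j e = begin
    + w j ℤ.* ((+ v j ℤ.+ + e ℤ.+ + p ℤ.- + d j) ℤ.⊔ + 0)
      ≤⟨ ℤ.*-monoˡ-≤-nonNeg (+ w j) (ℤ.⊔-lub
           (ℤ.≤-trans (ℤ.≤-reflexive (solve 4 (λ v e p d → v :+ e :+ p :- d := v :+ p :- d :+ e) refl
                                        (+ v j) (+ e) (+ p) (+ d j)))
                      (ℤ.+-monoˡ-≤ (+ e) (ℤ.i≤i⊔j x (+ 0))))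
           (ℤ.≤-trans (ℤ.i≤j⊔i x (+ 0)) (ℤ.i≤i+j (x ℤ.⊔ + 0) (+ e)))) ⟩
    + w j ℤ.* (x ℤ.⊔ + 0 ℤ.+ + e)
      ≡⟨ ℤ.*-distribˡ-+ (+ w j) (x ℤ.⊔ + 0) (+ e) ⟩
    + w j ℤ.* (x ℤ.⊔ + 0) ℤ.+ + w j ℤ.* + e
      ≡⟨ cong (λ y → + w j ℤ.* (x ℤ.⊔ + 0) ℤ.+ y) (ℤ.pos-* (w j) e) ⟨
    + w j ℤ.* (x ℤ.⊔ + 0) ℤ.+ + (w j ℕ.* e) ∎
    where
    open ℤ.≤-Reasoning
    open ℤ-Solver
    x = + v j ℤ.+ + p ℤ.- + d j

  cost-rounding : ∀ i → cost (rounding i) ℤ.≤ G ℤ.+ + ∑ℕ (λ j → w j ℕ.* delay i j)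
  cost-rounding i = ∑ℤ-mono-+ λ j → edgeCost-delay j (delay i j)

  -- Multiplied by 2 W and with all terms moved so that no subtraction occurs.
  average : ∀ c → (∀ i → c ℤ.≤ cost (rounding i)) →
            + (2 ℕ.* W) ℤ.* c ℤ.+ + (p ℕ.* ∑w²) ℤ.≤ + (2 ℕ.* W) ℤ.* G ℤ.+ + (p ℕ.* W ℕ.^ 2)
  average c c≤ = begin
    + (2 ℕ.* W) ℤ.* c ℤ.+ + (p ℕ.* ∑w²)
      ≡⟨ cong (λ z → z ℤ.* c ℤ.+ + (p ℕ.* ∑w²)) (ℤ.pos-* 2 W) ⟩
    + 2 ℤ.* + W ℤ.* c ℤ.+ + (p ℕ.* ∑w²)
      ≡⟨ cong (ℤ._+ + (p ℕ.* ∑w²)) (ℤ.*-assoc (+ 2) (+ W) c) ⟩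
    + 2 ℤ.* (+ W ℤ.* c) ℤ.+ + (p ℕ.* ∑w²)
      ≤⟨ ℤ.+-monoˡ-≤ (+ (p ℕ.* ∑w²)) (ℤ.*-monoˡ-≤-nonNeg (+ 2)
           (weighted-average w Δ c G λ i → ℤ.≤-trans (c≤ i) (cost-rounding i))) ⟩
    + 2 ℤ.* (+ W ℤ.* G ℤ.+ + A) ℤ.+ + (p ℕ.* ∑w²)
      ≡⟨ solve 4 (λ w g a q → con (+ 2) :* (w :* g :+ a) :+ q :=
                    con (+ 2) :* w :* g :+ (con (+ 2) :* a :+ q)) refl (+ W) G (+ A) (+ (p ℕ.* ∑w²)) ⟩
    + 2 ℤ.* + W ℤ.* G ℤ.+ (+ 2 ℤ.* + A ℤ.+ + (p ℕ.* ∑w²))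
      ≡⟨ cong₂ (λ y z → y ℤ.* G ℤ.+ (z ℤ.+ + (p ℕ.* ∑w²))) (ℤ.pos-* 2 W) (ℤ.pos-* 2 A) ⟨
    + (2 ℕ.* W) ℤ.* G ℤ.+ + (2 ℕ.* A ℕ.+ p ℕ.* ∑w²)
      ≤⟨ ℤ.+-monoʳ-≤ (+ (2 ℕ.* W) ℤ.* G) (ℤ.+≤+ (∑∑-pairing p w delay delay-pair delay-diagonal)) ⟩
    + (2 ℕ.* W) ℤ.* G ℤ.+ + (p ℕ.* W ℕ.^ 2) ∎
    where
    open ℤ.≤-Reasoning
    open ℤ-Solver
    Δ : Fin N → ℕ
    Δ i = ∑ℕ λ j → w j ℕ.* delay i j
    A = ∑ℕ λ i → w i ℕ.* Δ i

-- Arithmetic of the additive bound and of the ratio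

module Constants (p W Q N : ℕ) {{W≢0 : NonZero W}} .{{_ : NonZero (2 ℕ.* W)}}
                 .{{_ : NonZero (2 ℕ.* W ℕ.^ 2)}} .{{_ : NonZero (2 ℕ.* N)}} where
  open ℚ-Solver

  -- With `Q` the sum of the squared weights, `D′` is `D` and `ρ` is the claimed ratio.
  D′ Q/2W² ρ : ℚ
  D′ = (+ p ℚ./ (2 ℕ.* W)) ℚ.* (ℕ→ℚ (W ℕ.^ 2) ℚ.- ℕ→ℚ Q)
  Q/2W² = + Q ℚ./ (2 ℕ.* W ℕ.^ 2)
  ρ = (+ 3 ℚ./ 2) ℚ.- Q/2W²

  private
    u q w : ℚ
    u = + p ℚ./ (2 ℕ.* W)
    q = Q/2W²
    w = ℕ→ℚ W

    2W≡ : ℕ→ℚ (2 ℕ.* W) ≡ ℕ→ℚ 2 ℚ.* w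
    2W≡ = ℕ→ℚ-* 2 W

    W²≡ : ℕ→ℚ (W ℕ.^ 2) ≡ w ℚ.* w
    W²≡ = trans (ℕ→ℚ-* W (W ℕ.* 1)) (cong (λ n → w ℚ.* ℕ→ℚ n) (ℕ.*-identityʳ W))

    u*2W≡p : u ℚ.* (ℕ→ℚ 2 ℚ.* w) ≡ ℕ→ℚ p
    u*2W≡p = trans (cong (u ℚ.*_) (sym 2W≡)) (/-*-cancel (+ p) (2 ℕ.* W))

    q*2W²≡Q : q ℚ.* (ℕ→ℚ 2 ℚ.* (w ℚ.* w)) ≡ ℕ→ℚ Q
    q*2W²≡Q = trans
      (cong (q ℚ.*_) (sym (trans (ℕ→ℚ-* 2 (W ℕ.^ 2)) (cong (ℕ→ℚ 2 ℚ.*_) W²≡))))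
      (/-*-cancel (+ Q) (2 ℕ.* W ℕ.^ 2))

  -- Writing `Q` as `q * 2W²` and `p` as `u * 2W` removes the divisions and leaves a polynomial
  -- identity in `u`, `w` and `q`.
  D≡[ρ-1]pW : D′ ≡ (ρ ℚ.- 1ℚ) ℚ.* ℕ→ℚ (p ℕ.* W)
  D≡[ρ-1]pW = begin
    u ℚ.* (ℕ→ℚ (W ℕ.^ 2) ℚ.- ℕ→ℚ Q)
      ≡⟨ cong₂ (λ x y → u ℚ.* (x ℚ.- y)) W²≡ (sym q*2W²≡Q) ⟩
    u ℚ.* (w ℚ.* w ℚ.- q ℚ.* (ℕ→ℚ 2 ℚ.* (w ℚ.* w)))
      ≡⟨ solve 3 (λ u w q → u :* (w :* w :- q :* (con (ℕ→ℚ 2) :* (w :* w)))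
           := (con (+ 3 ℚ./ 2) :- q :- con 1ℚ) :* (u :* (con (ℕ→ℚ 2) :* w) :* w)) refl u w q ⟩
    (ρ ℚ.- 1ℚ) ℚ.* (u ℚ.* (ℕ→ℚ 2 ℚ.* w) ℚ.* w)
      ≡⟨ cong (λ z → (ρ ℚ.- 1ℚ) ℚ.* (z ℚ.* w)) u*2W≡p ⟩
    (ρ ℚ.- 1ℚ) ℚ.* (ℕ→ℚ p ℚ.* w)
      ≡⟨ cong ((ρ ℚ.- 1ℚ) ℚ.*_) (ℕ→ℚ-* p W) ⟨
    (ρ ℚ.- 1ℚ) ℚ.* ℕ→ℚ (p ℕ.* W) ∎
    where open ≡-Reasoning

  -- Multiplication by `2W` turns `D′` into `p (W² - Q)`, so that the integer bound divided by `2W`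
  -- is the claim.
  ≤+D : ∀ c G → + (2 ℕ.* W) ℤ.* c ℤ.+ + (p ℕ.* Q) ℤ.≤ + (2 ℕ.* W) ℤ.* G ℤ.+ + (p ℕ.* W ℕ.^ 2) →
        c ℚ./ 1 ℚ.≤ G ℚ./ 1 ℚ.+ D′
  ≤+D c G bound = ℚ.*-cancelˡ-≤-pos (ℕ→ℚ (2 ℕ.* W))
    {{ℚ.positive (0<ℕ→ℚ (2 ℕ.* W) {{ℕ.m*n≢0 2 W}})}} (begin
    t ℚ.* (c ℚ./ 1)
      ≡⟨ solve 2 (λ x y → x := x :+ y :- y) refl (t ℚ.* (c ℚ./ 1)) (ℕ→ℚ (p ℕ.* Q)) ⟩
    t ℚ.* (c ℚ./ 1) ℚ.+ ℕ→ℚ (p ℕ.* Q) ℚ.- ℕ→ℚ (p ℕ.* Q)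
      ≤⟨ ℚ.+-monoˡ-≤ (ℚ.- ℕ→ℚ (p ℕ.* Q)) (subst₂ ℚ._≤_ (linear c (p ℕ.* Q)) (linear G (p ℕ.* W ℕ.^ 2)) (/1-mono-≤ bound)) ⟩
    t ℚ.* (G ℚ./ 1) ℚ.+ ℕ→ℚ (p ℕ.* W ℕ.^ 2) ℚ.- ℕ→ℚ (p ℕ.* Q)
      ≡⟨ cong₂ (λ x y → t ℚ.* (G ℚ./ 1) ℚ.+ x ℚ.- y) (ℕ→ℚ-* p (W ℕ.^ 2)) (ℕ→ℚ-* p Q) ⟩
    t ℚ.* (G ℚ./ 1) ℚ.+ ℕ→ℚ p ℚ.* ℕ→ℚ (W ℕ.^ 2) ℚ.- ℕ→ℚ p ℚ.* ℕ→ℚ Q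
      ≡⟨ cong (λ x → t ℚ.* (G ℚ./ 1) ℚ.+ x ℚ.* ℕ→ℚ (W ℕ.^ 2) ℚ.- x ℚ.* ℕ→ℚ Q) (/-*-cancel (+ p) (2 ℕ.* W)) ⟨
    t ℚ.* (G ℚ./ 1) ℚ.+ (u ℚ.* t) ℚ.* ℕ→ℚ (W ℕ.^ 2) ℚ.- (u ℚ.* t) ℚ.* ℕ→ℚ Q
      ≡⟨ solve 5 (λ t g u x y → t :* g :+ (u :* t) :* x :- (u :* t) :* y := t :* (g :+ u :* (x :- y))) refl
           t (G ℚ./ 1) u (ℕ→ℚ (W ℕ.^ 2)) (ℕ→ℚ Q) ⟩
    t ℚ.* (G ℚ./ 1 ℚ.+ D′) ∎)
    where
    open ℚ.≤-Reasoning
    t : ℚ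
    t = ℕ→ℚ (2 ℕ.* W)
    linear : ∀ z m → (+ (2 ℕ.* W) ℤ.* z ℤ.+ + m) ℚ./ 1 ≡ t ℚ.* (z ℚ./ 1) ℚ.+ ℕ→ℚ m
    linear z m = trans (/1-+ (+ (2 ℕ.* W) ℤ.* z) (+ m)) (cong (ℚ._+ ℕ→ℚ m) (/1-* (+ (2 ℕ.* W)) z))

  ρ-1≥0 : Q ℕ.≤ W ℕ.^ 2 → 0ℚ ℚ.≤ ρ ℚ.- 1ℚ
  ρ-1≥0 Q≤W² = subst₂ ℚ._≤_ (ℚ.+-inverseʳ ½)
    (solve 1 (λ q → con ½ :- q := con (+ 3 ℚ./ 2) :- q :- con 1ℚ) refl q)
    (ℚ.+-monoʳ-≤ ½ (ℚ.neg-antimono-≤ (ℕ/-mono-≤ Q (2 ℕ.* W ℕ.^ 2) 1 2 (begin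
      Q ℕ.* 2                   ≡⟨ ℕ.*-comm Q 2 ⟩
      2 ℕ.* Q                   ≤⟨ ℕ.*-monoʳ-≤ 2 Q≤W² ⟩
      2 ℕ.* W ℕ.^ 2             ≡⟨ ℕ.*-identityˡ (2 ℕ.* W ℕ.^ 2) ⟨
      1 ℕ.* (2 ℕ.* W ℕ.^ 2)     ∎))))
    where open ℕ.≤-Reasoning

  ρ≤3/2-1/2N : W ℕ.^ 2 ℕ.≤ N ℕ.* Q → ρ ℚ.≤ (+ 3 ℚ./ 2) ℚ.- (+ 1 ℚ./ (2 ℕ.* N))
  ρ≤3/2-1/2N W²≤NQ = ℚ.+-monoʳ-≤ (+ 3 ℚ./ 2) (ℚ.neg-antimono-≤ (ℕ/-mono-≤ 1 (2 ℕ.* N) Q (2 ℕ.* W ℕ.^ 2) (begin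
    1 ℕ.* (2 ℕ.* W ℕ.^ 2)   ≡⟨ ℕ.*-identityˡ (2 ℕ.* W ℕ.^ 2) ⟩
    2 ℕ.* W ℕ.^ 2           ≤⟨ ℕ.*-monoʳ-≤ 2 W²≤NQ ⟩
    2 ℕ.* (N ℕ.* Q)         ≡⟨ ℕ.*-assoc 2 N Q ⟨
    2 ℕ.* N ℕ.* Q           ≡⟨ ℕ.*-comm (2 ℕ.* N) Q ⟩
    Q ℕ.* (2 ℕ.* N)         ∎)))
    where open ℕ.≤-Reasoning

  3/2-1/2N<3/2 : (+ 3 ℚ./ 2) ℚ.- (+ 1 ℚ./ (2 ℕ.* N)) ℚ.< + 3 ℚ./ 2
  3/2-1/2N<3/2 = ℚ.+-monoʳ-< (+ 3 ℚ./ 2)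
    (ℚ.neg-antimono-< (ℚ.positive⁻¹ (+ 1 ℚ./ (2 ℕ.* N)) {{ℚ.normalize-pos 1 (2 ℕ.* N)}}))

-- Comparison with the optimum

∑ℤ-nonNeg : ∀ {n} (f : Vector ℤ n) → (∀ j → + 0 ℤ.≤ f j) → + 0 ℤ.≤ ∑ℤ f
∑ℤ-nonNeg {zero}  f f≥0 = ℤ.≤-refl
∑ℤ-nonNeg {suc n} f f≥0 = ℤ.+-mono-≤ (f≥0 zero) (∑ℤ-nonNeg (f ∘ suc) (f≥0 ∘ suc))

-- The excess `e = (ρ - 1) c` is at most `(ρ - 1) y` because `c ≤ y`, which gives `x ≤ ρ y`.
ratio-bound : ∀ {x y c e ρ} → x ≤ y + fromℚ e → fromℚ c ≤ y → e ≡ (ρ ℚ.- 1ℚ) ℚ.* c →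
              0ℚ ℚ.≤ ρ ℚ.- 1ℚ → (y>0 : 0ℝ < y) → x ÷ y [ y>0 ] ≤ fromℚ ρ
ratio-bound {x} {y} {c} {e} {ρ} x≤y+e c≤y e≡ ρ≥1 y>0 = x≤ρy⇒x÷y≤ρ y>0
  (≤-trans x≤y+e (≤-trans (+-mono-≤ ≤-refl e≤) (y+[ρ-1]y≤ρy ρ y)))
  where
  e≤ : fromℚ e ≤ fromℚ (ρ ℚ.- 1ℚ) * y
  e≤ = ≤-trans (fromℚ-mono-≤ (ℚ.≤-reflexive e≡))
    (≤-trans (proj₁ (fromℚ-* (ρ ℚ.- 1ℚ) c)) (fromℚ-*-mono-≤ ρ≥1 c≤y))

module Comparison (I : Instance) (S : Problem.Schedule I) (run : Problem.Run I) where
  open Problem I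
  open Shifting I S using (leftShifted; G≤F)
  open IntegerSchedule leftShifted using (G)
  open Rounding I leftShifted
  open Run run using (matchings; phase; phase∈; least)

  cost-alg : ℤ
  cost-alg = cost (matching matchings phase phase∈)

  -- The returned schedule is no worse than the candidate of the phase of `v i`, and the optimal
  -- matching behind that candidate is no worse than the rounding, a matching of the same phase.
  cost-alg≤ : ∀ i → cost-alg ℤ.≤ cost (rounding i)
  cost-alg≤ i = ℤ.≤-trans
    (fromℤ-cancel-≤ (≤-trans (proj₂ (F-schedule I (matching matchings phase phase∈)))
      (≤-trans (least (phaseOf i) (phaseOf∈𝒜 i))
        (proj₁ (F-schedule I (matching matchings (phaseOf i) (phaseOf∈𝒜 i)))))))
    (optimal matchings (phaseOf i) (phaseOf∈𝒜 i) (rounding i))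

  F-alg≤F+D : F (S-alg run) ≤ F S + fromℚ D
  F-alg≤F+D = ≤-trans (proj₁ (F-schedule I (matching matchings phase phase∈)))
    (≤-trans (fromℚ-mono-≤ (Constants.≤+D p W ∑w² N cost-alg G (average cost-alg cost-alg≤)))
      (≤-trans (proj₁ (fromℚ-+ (G ℚ./ 1) D)) (+-mono-≤ G≤F ≤-refl)))

-- The cost of the left-shifted starts is a lower bound and a sum of nonnegative integers.
F≥0 : ∀ I S → 0ℝ ≤ Problem.F I S
F≥0 I S = ≤-trans (fromℚ-mono-≤ (/1-mono-≤ (∑ℤ-nonNeg _ λ j → edgeCost≥0 j (+ v j)))) (Shifting.G≤F I S)
  where
  open Problem I
  open IntegerSchedule (Shifting.leftShifted I S) using (v)
  edgeCost≥0 : ∀ j t → + 0 ℤ.≤ edgeCost j t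
  edgeCost≥0 j t = subst (ℤ._≤ edgeCost j t) (ℤ.*-zeroʳ (+ w j))
    (ℤ.*-monoˡ-≤-nonNeg (+ w j) (ℤ.i≤j⊔i (t ℤ.+ + p ℤ.- + d j) (+ 0)))

theorem2 : (I : Instance) → let open Problem I in
    (F* : ℝ) → IsMinimumCost F* → (run : Run) →
    (F (S-alg run) ≤ F* + fromℚ D)
    × (Σ[ Φ*>0 ∈ 0ℝ < Φ F* ]
    Φ (F (S-alg run)) ÷ Φ F* [ Φ*>0 ]
    ≤ fromℚ ((+ 3 ℚ./ 2) ℚ.- (+ ∑w² ℚ./ (2 ℕ.* W ℕ.^ 2))))
    × ((+ 3 ℚ./ 2) ℚ.- (+ ∑w² ℚ./ (2 ℕ.* W ℕ.^ 2)) ℚ.≤ (+ 3 ℚ./ 2) ℚ.- (+ 1 ℚ./ (2 ℕ.* N)))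
    × ((+ 3 ℚ./ 2) ℚ.- (+ 1 ℚ./ (2 ℕ.* N)) ℚ.< + 3 ℚ./ 2)
-- The schedule to be shifted and rounded is an optimal one, so its cost can be replaced by `F*`.
theorem2 I F* ((S , FS≤F* , F*≤FS) , _) run =
  F-alg≤F*+D ,
  (Φ*>0 , ratio-bound Φ-alg≤Φ*+D pW≤Φ* D≡[ρ-1]pW (ρ-1≥0 (∑²≤[∑]² w)) Φ*>0) ,
  ρ≤3/2-1/2N ([∑]²≤n∑² w) ,
  3/2-1/2N<3/2
  where
  open Problem I
  open Constants p W ∑w² N using (D≡[ρ-1]pW; ρ-1≥0; ρ≤3/2-1/2N; 3/2-1/2N<3/2)

  F-alg≤F*+D : F (S-alg run) ≤ F* + fromℚ D
  F-alg≤F*+D = ≤-trans (Comparison.F-alg≤F+D I S run) (+-mono-≤ FS≤F* ≤-refl)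

  Φ-alg≤Φ*+D : Φ (F (S-alg run)) ≤ Φ F* + fromℚ D
  Φ-alg≤Φ*+D = ≤-trans (+-mono-≤ F-alg≤F*+D ≤-refl) (+-swap-≤ F* (fromℚ D) (fromℕ (p ℕ.* W)))

  pW≤Φ* : fromℕ (p ℕ.* W) ≤ Φ F*
  -- Reading `p * W` as `0 + p * W` matches the 0 with the lower bound for `F*`.
  pW≤Φ* = ≤-trans (fromℕ-+ 0 (p ℕ.* W)) (+-mono-≤ (≤-trans (F≥0 I S) FS≤F*) ≤-refl)

  Φ*>0 : 0ℝ < Φ F*
  Φ*>0 = fromℚ≤⇒0< (0<ℕ→ℚ (p ℕ.* W) {{ℕ.m*n≢0 p W}}) pW≤Φ*
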